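{- The sets $\mathcal{K}_{\max}$, $\mathcal{R}$ and $\mathcal{F}$ are infinite subsets of $N_2$, each containing only finitely many elements of $N_1$. Moreover, $\mathcal{K}_{\min}$ is an infinite subset of $N_3$ containing infinitely many composite numbers. Here $\mathcal{K}_{\max}=\{K_{q,r}\colon q\text{ prime},\ q\equiv 3\pmod 4,\ r\in\mathbb{N}\}$, $\mathcal{K}_{\min}=\{k_{q,r}\colon q\text{ prime},\ q\equiv 3\pmod 4,\ r\in\mathbb{N}\}$, $\mathcal{R}=\{R(r_1,r_2)\colon r_1,r_2\in\mathbb{N},\ r_2>2\}$, and $\mathcal{F}=\{2^a\prod_{i=1}^k F_i\colon k\in H,\ a\in\mathbb{N},\ \text{and } a\le\log_2(F_{k+1}-1)\text{ if }F_{k+1}\text{ exists}\}$.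
   Context: $\phi$ is Euler's totient function, $V=\phi(\mathbb{N})$, $\phi^{ -1}(m)=\{x\colon\phi(x)=m\}$. For $m\in V$: $N_1(m)=\max\{x\in\mathbb{N}\colon\phi(x)\le m\}$, $N_2(m)=\max\phi^{ -1}(m)$, $N_3(m)=\min\phi^{ -1}(m)$, and $N_i=\{N_i(m)\colon m\in V\}$. For a prime $q$ and $r,r_1,r_2\in\mathbb{N}$: $K_{q,r}=2q^{r+1}$; $k_{q,r}=q^r(q-1)+1$ if $q^r(q-1)+1$ is prime and $k_{q,r}=q^{r+1}$ otherwise; $R(r_1,r_2)=2\cdot 3^{r_1}\cdot 5^{r_2}$. A Fermat prime is a prime of the form $2^{2^l}+1$ with $l\ge 0$; $F_j$ denotes the $j$-th Fermat prime in increasing order ($F_1=3,F_2=5,F_3=17,\dots$), and $H=\{k\in\mathbb{N}\colon F_k\text{ exists}\}$. -}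

module Defs where

open import Data.Nat using (ℕ; zero; suc; _+_; _*_; _∸_; _^_; _≤_; _<_; _≟_)
open import Data.Nat.GCD using (gcd)
open import Data.Nat.Primality using (Prime; Composite)
open import Data.Nat.DivMod using (_%_)
open import Data.Nat.Logarithm using (⌊log₂_⌋)
open import Data.List using (List; []; _∷_; length; filter; upTo)
open import Data.Nat.ListAction using (product)
open import Data.Empty using (⊥)
open import Data.List.Membership.Propositional using (_∈_)
open import Data.List.Relation.Unary.All using (All)
open import Data.List.Relation.Unary.Unique.Propositional using (Unique)
open import Data.Product using (Σ; ∃; ∃-syntax; _×_; _,_)
open import Data.Sum using (_⊎_)
open import Relation.Nullary using (¬_)
open import Relation.Binary.PropositionalEquality using (_≡_)

φ : ℕ → ℕ
φ n = length (filter (λ k → gcd (suc k) n ≟ 1) (upTo n))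

-- Here ℕ = {1,2,3,…}: "x ∈ ℕ" is rendered as 1 ≤ x.

InV : ℕ → Set
InV m = ∃[ x ] (1 ≤ x × φ x ≡ m)

InPhiInv : ℕ → ℕ → Set
InPhiInv m x = 1 ≤ x × φ x ≡ m

IsN1 : ℕ → ℕ → Set
IsN1 m x = (1 ≤ x × φ x ≤ m) × (∀ y → 1 ≤ y → φ y ≤ m → y ≤ x)

IsN2 : ℕ → ℕ → Set
IsN2 m x = InPhiInv m x × (∀ y → InPhiInv m y → y ≤ x)

IsN3 : ℕ → ℕ → Set
IsN3 m x = InPhiInv m x × (∀ y → InPhiInv m y → x ≤ y)

N₁ N₂ N₃ : ℕ → Set
N₁ x = ∃[ m ] (InV m × IsN1 m x)
N₂ x = ∃[ m ] (InV m × IsN2 m x)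
N₃ x = ∃[ m ] (InV m × IsN3 m x)

_⊆_ : (ℕ → Set) → (ℕ → Set) → Set
S ⊆ T = ∀ x → S x → T x

Infinite : (ℕ → Set) → Set
Infinite S = ∀ n → ∃[ x ] (S x × n ≤ x)

FinitelyManyOf : (ℕ → Set) → (ℕ → Set) → Set
FinitelyManyOf S T = ∃[ B ] (∀ x → S x → T x → x < B)

InfinitelyManyOf : (ℕ → Set) → (ℕ → Set) → Set
InfinitelyManyOf S T = ∀ n → ∃[ x ] (S x × T x × n ≤ x)

K : ℕ → ℕ → ℕ
K q r = 2 * q ^ (r + 1)

Isk : ℕ → ℕ → ℕ → Set
Isk q r x =
  (Prime (q ^ r * (q ∸ 1) + 1) × x ≡ q ^ r * (q ∸ 1) + 1)
  ⊎ (¬ Prime (q ^ r * (q ∸ 1) + 1) × x ≡ q ^ (r + 1))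

R : ℕ → ℕ → ℕ
R r₁ r₂ = 2 * 3 ^ r₁ * 5 ^ r₂

FermatPrime : ℕ → Set
FermatPrime p = Prime p × ∃[ l ] (p ≡ 2 ^ (2 ^ l) + 1)

-- p = F_j : p is a Fermat prime and exactly j-1 Fermat primes are < p
IsF : ℕ → ℕ → Set
IsF j p = FermatPrime p × 1 ≤ j ×
  Σ (List ℕ) λ xs → length xs + 1 ≡ j × Unique xs
    × All (λ y → FermatPrime y × y < p) xs
    × (∀ y → FermatPrime y → y < p → y ∈ xs)

InH : ℕ → Set
InH k = 1 ≤ k × ∃[ p ] IsF k p

FermatsFrom : ℕ → ℕ → List ℕ → Set
FermatsFrom i zero ys = ys ≡ []
FermatsFrom i (suc n) [] = ⊥
FermatsFrom i (suc n) (y ∷ ys) = IsF i y × FermatsFrom (suc i) n ys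

FirstFermats : ℕ → List ℕ → Set
FirstFermats k ps = FermatsFrom 1 k ps

𝒦max : ℕ → Set
𝒦max x = ∃[ q ] ∃[ r ] (Prime q × q % 4 ≡ 3 × 1 ≤ r × x ≡ K q r)

𝒦min : ℕ → Set
𝒦min x = ∃[ q ] ∃[ r ] (Prime q × q % 4 ≡ 3 × 1 ≤ r × Isk q r x)

ℛ : ℕ → Set
ℛ x = ∃[ r₁ ] ∃[ r₂ ] (1 ≤ r₁ × 2 < r₂ × x ≡ R r₁ r₂)

ℱ : ℕ → Set
ℱ x = ∃[ k ] ∃[ a ] Σ (List ℕ) λ ps →
  InH k × 1 ≤ a × FirstFermats k ps × x ≡ 2 ^ a * product ps
  × (∀ q → IsF (suc k) q → a ≤ ⌊log₂ (q ∸ 1) ⌋)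

{-# OPTIONS --safe #-}

-- Prime by prime, φ(p n) is p φ(n) or (p ∸ 1) φ(n), so φ(y) controls the primes dividing y.
-- For 𝒦max and 𝒦min, φ(y) = q^r (q ∸ 1) is 2 modulo 4, which forces y = p^e or y = 2 p^e.
-- For ℛ, 16 ∤ φ(y) leaves so few odd primes that y/φ(y) ≤ 15/4, the ratio attained on ℛ.
-- For ℱ, φ(y) is a power of 2, so the odd primes of y are Fermat primes; y is compared with
-- 2^a F₁ ⋯ F_k by cancelling common Fermat primes from the smallest on. At the first F that
-- divides only the latter, the factor F/(F ∸ 1) already outweighs all larger Fermat primes together.
-- All elements x of 𝒦max, ℛ and ℱ satisfy x/φ(x) ≤ 4, whereas y/φ(y) ≥ 35/8 for multiples y of 210.

module Submission where

open import Defs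
open import Data.Nat
open import Data.Nat.Coprimality as Coprime using (Coprime)
open import Data.Nat.Divisibility
open import Data.Nat.DivMod using (_%_; _/_; m≡m%n+[m/n]*n; m%n<n; m%n≤m; /-monoˡ-≤)
open import Data.Nat.GCD using (gcd)
open import Data.Nat.Induction using (<-rec)
open import Data.Nat.ListAction using (product)
open import Data.Nat.Logarithm using (⌊log₂_⌋; ⌊log₂⌋-mono-≤; ⌊log₂[2^n]⌋≡n)
open import Data.Nat.Primality
open import Data.Nat.Primality.Factorisation using (factorise; PrimeFactorisation; factorisationHasAllPrimeFactors)
open import Data.Nat.Properties
open import Data.Nat.Tactic.RingSolver using (solve-∀)
open import Data.Bool using (if_then_else_)
open import Data.List using (List; []; _∷_; length; filter; upTo; _++_; _∷ʳ_)
open import Data.List.Membership.Propositional using (_∈_)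
open import Data.List.Membership.Propositional.Properties using (∈-∃++; ∈-++⁻; ∈-++⁺ˡ; ∈-++⁺ʳ; ∈-filter⁺; ∈-filter⁻; ∈-upTo⁺; ∈-upTo⁻)
open import Data.List.Properties using (upTo-∷ʳ; filter-++; length-++; ++-identityʳ; filter-accept; filter-reject)
open import Data.List.Relation.Unary.All as All using (All; []; _∷_)
open import Data.List.Relation.Unary.AllPairs using (AllPairs; []; _∷_)
open import Data.List.Relation.Unary.Any using (here; there)
open import Data.List.Relation.Unary.Unique.Propositional using (Unique)
import Data.List.Relation.Unary.Unique.Propositional.Properties as Unique
open import Data.Product using (∃-syntax; _×_; _,_; proj₁; proj₂)
open import Data.Sum using (_⊎_; inj₁; inj₂; [_,_]′)
open import Function using (_∘_)
open import Relation.Binary.PropositionalEquality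
open import Relation.Nullary using (¬_; Dec; yes; no; does; contradiction)
open import Relation.Nullary.Decidable using (True; False; toWitness; toWitnessFalse; from-yes; from-no; map′; _×-dec_)
open import Relation.Unary using (Pred; Decidable)

-- Recursion for φ along primes

-- On a fibre of φ the larger number has the larger ratio y/φ(y), so membership in N₂ amounts to a
-- bound on this ratio. The ratio is the product of p/(p - 1) over the primes p dividing y:
-- exponents drop out, and lower bounds for the odd primes suffice. On ℛ the condition 16 ∤ φ(y)
-- leaves one prime set with a ratio above 15/4, namely {2, 3, 7, 11} with 77/20. The condition r₂ >
-- 2 forces 25 ∣ φ(y), which excludes it. On ℱ the bound on a is what keeps F_{k+1} = 2^(2^l) + 1
-- out: if a > 2^l, then 2^(a - 2^l) F₁ ⋯ F_{k+1} would have the same φ and be larger.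

∑ : ℕ → (ℕ → ℕ) → ℕ
∑ zero    f = 0
∑ (suc n) f = ∑ n f + f n

∑-cong : ∀ n {f g : ℕ → ℕ} → (∀ k → f k ≡ g k) → ∑ n f ≡ ∑ n g
∑-cong zero    f≗g = refl
∑-cong (suc n) f≗g = cong₂ _+_ (∑-cong n f≗g) (f≗g n)

∑-zero : ∀ n {f : ℕ → ℕ} → (∀ k → k < n → f k ≡ 0) → ∑ n f ≡ 0
∑-zero zero    f≗0 = refl
∑-zero (suc n) f≗0 = cong₂ _+_ (∑-zero n λ k k<n → f≗0 k (m<n⇒m<1+n k<n)) (f≗0 n ≤-refl)

∑-distrib-+ : ∀ n (f g : ℕ → ℕ) → ∑ n (λ k → f k + g k) ≡ ∑ n f + ∑ n g
∑-distrib-+ zero    f g = refl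
∑-distrib-+ (suc n) f g rewrite ∑-distrib-+ n f g = interchange (∑ n f) (∑ n g) (f n) (g n)
  where
  interchange : ∀ a b c d → a + b + (c + d) ≡ a + c + (b + d)
  interchange = solve-∀

∑-split : ∀ m n (f : ℕ → ℕ) → ∑ (m + n) f ≡ ∑ m f + ∑ n (λ k → f (m + k))
∑-split m zero    f rewrite +-identityʳ m = sym (+-identityʳ _)
∑-split m (suc n) f rewrite +-suc m n | ∑-split m n f = +-assoc (∑ m f) _ _

∑-blocks : ∀ m n (f : ℕ → ℕ) → ∑ (m * n) f ≡ ∑ m (λ j → ∑ n (λ i → f (j * n + i)))
∑-blocks zero    n f = refl
∑-blocks (suc m) n f = begin
  ∑ (n + m * n) f                                  ≡⟨ cong (λ l → ∑ l f) (+-comm n (m * n)) ⟩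
  ∑ (m * n + n) f                                  ≡⟨ ∑-split (m * n) n f ⟩
  ∑ (m * n) f + ∑ n (λ i → f (m * n + i))          ≡⟨ cong (_+ ∑ n (λ i → f (m * n + i))) (∑-blocks m n f) ⟩
  ∑ (suc m) (λ j → ∑ n (λ i → f (j * n + i)))      ∎
  where open ≡-Reasoning

∑-const : ∀ m c → ∑ m (λ _ → c) ≡ m * c
∑-const zero    c = refl
∑-const (suc m) c rewrite ∑-const m c = +-comm (m * c) c

𝟙 : ∀ {P : Set} → Dec P → ℕ
𝟙 P? = if does P? then 1 else 0

𝟙-cong : ∀ {P Q : Set} (P? : Dec P) (Q? : Dec Q) → (P → Q) → (Q → P) → 𝟙 P? ≡ 𝟙 Q?
𝟙-cong (yes p) (yes q) f g = refl
𝟙-cong (yes p) (no ¬q) f g = contradiction (f p) ¬q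
𝟙-cong (no ¬p) (yes q) f g = contradiction (g q) ¬p
𝟙-cong (no ¬p) (no ¬q) f g = refl

𝟙-no : ∀ {P : Set} (P? : Dec P) → ¬ P → 𝟙 P? ≡ 0
𝟙-no (yes p) ¬p = contradiction p ¬p
𝟙-no (no _)  ¬p = refl

length-filter-upTo : ∀ {P : Pred ℕ _} (P? : Decidable P) n → length (filter P? (upTo n)) ≡ ∑ n (λ k → 𝟙 (P? k))
length-filter-upTo P? zero    = refl
length-filter-upTo P? (suc n) = begin
  length (filter P? (upTo (suc n)))                      ≡⟨ cong (length ∘ filter P?) (upTo-∷ʳ n) ⟨
  length (filter P? (upTo n ∷ʳ n))                       ≡⟨ cong length (filter-++ P? (upTo n) (n ∷ [])) ⟩
  length (filter P? (upTo n) ++ filter P? (n ∷ []))      ≡⟨ length-++ (filter P? (upTo n)) ⟩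
  length (filter P? (upTo n)) + length (filter P? (n ∷ []))
    ≡⟨ cong₂ _+_ (length-filter-upTo P? n) singleton ⟩
  ∑ n (λ k → 𝟙 (P? k)) + 𝟙 (P? n)                        ∎
  where
  open ≡-Reasoning
  singleton : length (filter P? (n ∷ [])) ≡ 𝟙 (P? n)
  singleton with P? n
  ... | yes _ = refl
  ... | no  _ = refl

-- As in `φ`, the index `k` stands for the integer `k + 1`.
χ : ℕ → ℕ → ℕ
χ n k = 𝟙 (gcd (suc k) n ≟ 1)

φ≡∑χ : ∀ n → φ n ≡ ∑ n (χ n)
φ≡∑χ n = length-filter-upTo (λ k → gcd (suc k) n ≟ 1) n

coprime-*ʳ : ∀ {k m n} → Coprime k m → Coprime k n → Coprime k (m * n)
coprime-*ʳ k⊥m k⊥n (d∣k , d∣mn) =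
  k⊥n (d∣k , Coprime.coprime-divisor (λ (e∣d , e∣m) → k⊥m (∣-trans e∣d d∣k , e∣m)) d∣mn)

coprime-*ʳ⁻ : ∀ {k} m {n} → Coprime k (m * n) → Coprime k n
coprime-*ʳ⁻ m k⊥mn (d∣k , d∣n) = k⊥mn (d∣k , ∣n⇒∣m*n m d∣n)

∤⇒coprime : ∀ {p n} → Prime p → p ∤ n → Coprime n p
∤⇒coprime pr p∤n (d∣n , d∣p) with prime⇒irreducible pr d∣p
... | inj₁ d≡1  = d≡1
... | inj₂ refl = contradiction d∣n p∤n

coprime⇒∤ : ∀ {p k} n → Prime p → Coprime k (p * n) → p ∤ k
coprime⇒∤ n pr k⊥pn p∣k = ¬prime[1] (subst Prime (k⊥pn (p∣k , m∣m*n n)) pr)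

coprime-+* : ∀ {k n} j → Coprime k n → Coprime (k + j * n) n
coprime-+* {k} {n} j k⊥n {d} (d∣k+jn , d∣n) =
  k⊥n (∣m+n∣m⇒∣n (subst (d ∣_) (+-comm k (j * n)) d∣k+jn) (∣n⇒∣m*n j d∣n) , d∣n)

coprime-+*⁻ : ∀ {k n} j → Coprime (k + j * n) n → Coprime k n
coprime-+*⁻ j k+jn⊥n (d∣k , d∣n) = k+jn⊥n (∣m∣n⇒∣m+n d∣k (∣n⇒∣m*n j d∣n) , d∣n)

χ-cong : ∀ m n k l → (Coprime (suc k) m → Coprime (suc l) n) → (Coprime (suc l) n → Coprime (suc k) m) →
         χ m k ≡ χ n l
χ-cong m n k l f g = 𝟙-cong (_ ≟ _) (_ ≟ _)
  (Coprime.coprime⇒gcd≡1 ∘ f ∘ Coprime.gcd≡1⇒coprime)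
  (Coprime.coprime⇒gcd≡1 ∘ g ∘ Coprime.gcd≡1⇒coprime)

-- Coprimality to `n` has period `n`, so each of the `m` blocks of length `n` contributes `φ n`.
∑χ-periods : ∀ m n → ∑ (m * n) (χ n) ≡ m * φ n
∑χ-periods m n = begin
  ∑ (m * n) (χ n)                          ≡⟨ ∑-blocks m n (χ n) ⟩
  ∑ m (λ j → ∑ n (λ i → χ n (j * n + i)))  ≡⟨ ∑-cong m (λ j → ∑-cong n (shift j)) ⟩
  ∑ m (λ _ → ∑ n (χ n))                    ≡⟨ ∑-const m (∑ n (χ n)) ⟩
  m * ∑ n (χ n)                            ≡⟨ cong (m *_) (φ≡∑χ n) ⟨
  m * φ n                                  ∎
  where
  open ≡-Reasoning
  shift : ∀ j i → χ n (j * n + i) ≡ χ n i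
  shift j i rewrite +-comm (j * n) i = χ-cong n n (i + j * n) i (coprime-+*⁻ {suc i} j) (coprime-+* {suc i} j)

φ-∣ : ∀ {p n} → Prime p → p ∣ n → φ (p * n) ≡ p * φ n
φ-∣ {p} {n} pr p∣n = begin
  φ (p * n)              ≡⟨ φ≡∑χ (p * n) ⟩
  ∑ (p * n) (χ (p * n))  ≡⟨ ∑-cong (p * n) (λ k → χ-cong (p * n) n k k (coprime-*ʳ⁻ p) coprime-p*n) ⟩
  ∑ (p * n) (χ n)        ≡⟨ ∑χ-periods p n ⟩
  p * φ n                ∎
  where
  open ≡-Reasoning
  coprime-p*n : ∀ {k} → Coprime k n → Coprime k (p * n)
  coprime-p*n k⊥n = coprime-*ʳ (λ (d∣k , d∣p) → k⊥n (d∣k , ∣-trans d∣p p∣n)) k⊥n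

-- Among the numbers up to p n coprime to n, those not coprime to p n are
-- the multiples p j with j ≤ n coprime to n.
φ-∤-+ : ∀ {p n} → Prime p → p ∤ n → φ (p * n) + φ n ≡ p * φ n
φ-∤-+ {zero}  {n} pr p∤n = contradiction pr ¬prime[0]
φ-∤-+ {p@(suc p-1)} {n} pr p∤n = begin
  φ (p * n) + φ n                          ≡⟨ cong₂ _+_ (φ≡∑χ (p * n)) (sym ∑ψ) ⟩
  ∑ (p * n) (χ (p * n)) + ∑ (p * n) ψ      ≡⟨ ∑-distrib-+ (p * n) (χ (p * n)) ψ ⟨
  ∑ (p * n) (λ k → χ (p * n) k + ψ k)      ≡⟨ ∑-cong (p * n) χ-split ⟩
  ∑ (p * n) (χ n)                          ≡⟨ ∑χ-periods p n ⟩
  p * φ n                                  ∎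
  where
  open ≡-Reasoning
  ψ? : ∀ k → Dec (p ∣ suc k × gcd (suc k) n ≡ 1)
  ψ? k = (p ∣? suc k) ×-dec (gcd (suc k) n ≟ 1)

  ψ : ℕ → ℕ
  ψ k = 𝟙 (ψ? k)

  χ-split : ∀ k → χ (p * n) k + ψ k ≡ χ n k
  χ-split k with p ∣? suc k
  ... | yes p∣k = cong₂ _+_
    (𝟙-no (gcd (suc k) (p * n) ≟ 1) λ eq → coprime⇒∤ n pr (Coprime.gcd≡1⇒coprime eq) p∣k)
    (𝟙-cong (ψ? k) (gcd (suc k) n ≟ 1) proj₂ (p∣k ,_))
  ... | no  p∤k = trans (cong₂ _+_ (χ-cong (p * n) n k k (coprime-*ʳ⁻ p) (coprime-*ʳ (∤⇒coprime pr p∤k)))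
                                   (𝟙-no (ψ? k) (p∤k ∘ proj₁)))
                        (+-identityʳ (χ n k))

  -- Because of the index shift, the only multiple of `p` in a block of length `p` sits at its last
  -- index.
  last-in-block : ∀ j → suc (j * p + p-1) ≡ p * suc j
  last-in-block j = trans (sym (+-suc (j * p) p-1)) (trans (+-comm (j * p) p) (*-comm (suc j) p))

  ψ-block : ∀ j i → i < p-1 → ψ (j * p + i) ≡ 0
  ψ-block j i i<p-1 = 𝟙-no (ψ? (j * p + i)) λ (p∣ , _) →
    <⇒≱ (s≤s i<p-1) (∣⇒≤ (∣m+n∣m⇒∣n (subst (p ∣_) (sym (+-suc (j * p) i)) p∣) (n∣m*n j)))

  ψ-last : ∀ j → ψ (j * p + p-1) ≡ χ n j
  ψ-last j = 𝟙-cong (ψ? (j * p + p-1)) (gcd (suc j) n ≟ 1)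
    (λ (_ , eq) → Coprime.coprime⇒gcd≡1 (Coprime.sym (coprime-*ʳ⁻ p (Coprime.sym
      (subst (λ k → Coprime k n) (last-in-block j) (Coprime.gcd≡1⇒coprime eq))))))
    (λ eq → subst (p ∣_) (sym (last-in-block j)) (m∣m*n (suc j)) ,
      Coprime.coprime⇒gcd≡1 (subst (λ k → Coprime k n) (sym (last-in-block j))
        (Coprime.sym (coprime-*ʳ (∤⇒coprime pr p∤n) (Coprime.sym (Coprime.gcd≡1⇒coprime eq))))))

  ∑ψ : ∑ (p * n) ψ ≡ φ n
  ∑ψ = begin
    ∑ (p * n) ψ                                ≡⟨ cong (λ l → ∑ l ψ) (*-comm p n) ⟩
    ∑ (n * p) ψ                                ≡⟨ ∑-blocks n p ψ ⟩
    ∑ n (λ j → ∑ p (λ i → ψ (j * p + i)))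
      ≡⟨ ∑-cong n (λ j → cong₂ _+_ (∑-zero p-1 (ψ-block j)) (ψ-last j)) ⟩
    ∑ n (χ n)                                  ≡⟨ φ≡∑χ n ⟨
    φ n                                        ∎

φ-∤ : ∀ {p n} → Prime p → p ∤ n → φ (p * n) ≡ (p ∸ 1) * φ n
φ-∤ {zero}          pr p∤n = contradiction pr ¬prime[0]
φ-∤ {suc p-1} {n} pr p∤n =
  -- With `p` matched as `suc p-1`, the product `p * φ n` unfolds to `φ n + p-1 * φ n`.
  +-cancelˡ-≡ (φ n) _ _ (trans (+-comm (φ n) _) (φ-∤-+ pr p∤n))

φ-^* : ∀ {p n} e → Prime p → p ∤ n → φ (p ^ suc e * n) ≡ p ^ e * (p ∸ 1) * φ n
φ-^* {p} {n} zero pr p∤n rewrite *-identityʳ p | +-identityʳ (p ∸ 1) = φ-∤ pr p∤n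
φ-^* {p} {n} (suc e) pr p∤n = begin
  φ (p * p ^ suc e * n)              ≡⟨ cong φ (*-assoc p (p ^ suc e) n) ⟩
  φ (p * (p ^ suc e * n))            ≡⟨ φ-∣ pr (∣m⇒∣m*n n (m∣m*n (p ^ e))) ⟩
  p * φ (p ^ suc e * n)              ≡⟨ cong (p *_) (φ-^* e pr p∤n) ⟩
  p * (p ^ e * (p ∸ 1) * φ n)        ≡⟨ *-assoc p (p ^ e * (p ∸ 1)) (φ n) ⟨
  p * (p ^ e * (p ∸ 1)) * φ n        ≡⟨ cong (_* φ n) (*-assoc p (p ^ e) (p ∸ 1)) ⟨
  p * p ^ e * (p ∸ 1) * φ n          ∎
  where open ≡-Reasoning

-- Submultiplicativity of φ and multiples of 210

φ-*≤ : ∀ {p} n → Prime p → φ (p * n) ≤ p * φ n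
φ-*≤ {p} n pr with p ∣? n
... | yes p∣n = ≤-reflexive (φ-∣ pr p∣n)
... | no  p∤n = ≤-trans (≤-reflexive (φ-∤ pr p∤n)) (*-monoˡ-≤ (φ n) (m∸n≤m p 1))

φ-product*≤ : ∀ {ps} n → All Prime ps → φ (product ps * n) ≤ product ps * φ n
φ-product*≤ n [] rewrite +-identityʳ n | +-identityʳ (φ n) = ≤-refl
φ-product*≤ {p ∷ ps} n (pr ∷ prs) = begin
  φ (p * product ps * n)    ≡⟨ cong φ (*-assoc p (product ps) n) ⟩
  φ (p * (product ps * n))  ≤⟨ φ-*≤ (product ps * n) pr ⟩
  p * φ (product ps * n)    ≤⟨ *-monoʳ-≤ p (φ-product*≤ n prs) ⟩
  p * (product ps * φ n)    ≡⟨ *-assoc p (product ps) (φ n) ⟨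
  p * product ps * φ n      ∎
  where open ≤-Reasoning

-- In terms of ratios: n/φ(n) can only grow on passing to a multiple of n.
φ-submult : ∀ t n .{{_ : NonZero t}} → φ (t * n) ≤ t * φ n
φ-submult t n = subst (λ s → φ (s * n) ≤ s * φ n) (sym isFactorisation) (φ-product*≤ n factorsPrime)
  where open PrimeFactorisation (factorise t)

prime[3] : Prime 3
prime[3] = from-yes (prime? 3)

prime[5] : Prime 5
prime[5] = from-yes (prime? 5)

prime[7] : Prime 7
prime[7] = from-yes (prime? 7)

φ-210 : φ 210 ≡ 48
φ-210 = begin
  φ (2 * 105)                       ≡⟨ φ-∤ prime[2] (toWitnessFalse {a? = 2 ∣? 105} _) ⟩
  1 * φ (3 * 35)                    ≡⟨ cong (1 *_) (φ-∤ prime[3] (toWitnessFalse {a? = 3 ∣? 35} _)) ⟩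
  1 * (2 * φ (5 * 7))               ≡⟨ cong (λ k → 1 * (2 * k)) (φ-∤ prime[5] (toWitnessFalse {a? = 5 ∣? 7} _)) ⟩
  48                                ∎
  where open ≡-Reasoning

-- 210 = 2·3·5·7 has φ(210)/210 = 8/35 < 1/4, so the first multiple of 210 above x
-- beats every large x with φ(x)/x ≥ 1/4.
N₁⇒<2310 : ∀ {x} → x ≤ 4 * φ x → N₁ x → x < 2310
N₁⇒<2310 {x} x≤4φx (m , _ , (_ , φx≤m) , max) = ≰⇒> λ 2310≤x →
  <⇒≱ x<y (max y (≤-trans (s≤s z≤n) x<y) (≤-trans (φy≤φx (/-monoˡ-≤ 210 2310≤x)) φx≤m))
  where
  u = x / 210
  y = suc u * 210

  x≡ : x ≡ x % 210 + u * 210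
  x≡ = m≡m%n+[m/n]*n x 210

  x<y : x < y
  x<y = subst (_< y) (sym x≡) (+-monoˡ-< (u * 210) (m%n<n x 210))

  -- The inequality 4 · 48 · (u + 1) ≤ 210 · u amounts to 192 ≤ 18 · u, hence `11 ≤ u` and the
  -- threshold 2310 = 11 · 210.
  φy≤φx : 11 ≤ u → φ y ≤ φ x
  φy≤φx 11≤u = *-cancelˡ-≤ 4 (begin
    4 * φ y              ≤⟨ *-monoʳ-≤ 4 (φ-submult (suc u) 210) ⟩
    4 * (suc u * φ 210)  ≡⟨ cong (λ k → 4 * (suc u * k)) φ-210 ⟩
    4 * (suc u * 48)     ≡⟨ *-comm 4 (suc u * 48) ⟩
    suc u * 48 * 4       ≡⟨ *-assoc (suc u) 48 4 ⟩
    192 + u * 192        ≤⟨ +-monoˡ-≤ (u * 192) (≤-trans (m≤m+n 192 6) (*-monoˡ-≤ 18 11≤u)) ⟩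
    u * 18 + u * 192     ≡⟨ *-distribˡ-+ u 18 192 ⟨
    u * 210              ≤⟨ m≤n+m (u * 210) (x % 210) ⟩
    x % 210 + u * 210    ≡⟨ x≡ ⟨
    x                    ≤⟨ x≤4φx ⟩
    4 * φ x              ∎)
    where open ≤-Reasoning

-- Odd prime factors and the parity of φ

prime>1 : ∀ {p} → Prime p → 1 < p
prime>1 pr = nonTrivial⇒n>1 _ {{prime⇒nonTrivial pr}}

prime∣prime⇒≡ : ∀ {p q} → Prime p → Prime q → p ∣ q → p ≡ q
prime∣prime⇒≡ pr qr p∣q with prime⇒irreducible qr p∣q
... | inj₁ refl = contradiction pr ¬prime[1]
... | inj₂ p≡q  = p≡q

prime∣^⇒∣ : ∀ {p a} n → Prime p → p ∣ a ^ n → p ∣ a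
prime∣^⇒∣ zero pr p∣1 = contradiction (subst Prime (∣1⇒≡1 p∣1) pr) ¬prime[1]
prime∣^⇒∣ {a = a} (suc n) pr p∣ = [ (λ d → d) , prime∣^⇒∣ n pr ]′ (euclidsLemma a (a ^ n) pr p∣)

∤1 : ∀ {p} → Prime p → p ∤ 1
∤1 pr p∣1 = ¬prime[1] (subst Prime (∣1⇒≡1 p∣1) pr)

φ-^ : ∀ {p} e → Prime p → φ (p ^ suc e) ≡ p ^ e * (p ∸ 1)
φ-^ {p} e pr = trans (cong φ (sym (*-identityʳ (p ^ suc e)))) (trans (φ-^* e pr (∤1 pr)) (*-identityʳ _))

φ-2^ : ∀ e → φ (2 ^ suc e) ≡ 2 ^ e
φ-2^ e = trans (φ-^ e prime[2]) (*-identityʳ (2 ^ e))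

even⊎odd : ∀ n → (∃[ h ] n ≡ 2 * h) ⊎ (∃[ h ] n ≡ suc (2 * h))
even⊎odd zero    = inj₁ (0 , refl)
even⊎odd (suc n) with even⊎odd n
... | inj₁ (h , refl) = inj₂ (h , refl)
... | inj₂ (h , refl) = inj₁ (suc h , cong suc (sym (+-suc h (h + 0))))

2∤odd : ∀ h → 2 ∤ suc (2 * h)
2∤odd h 2∣ = contradiction (∣1⇒≡1 (∣m+n∣m⇒∣n (subst (2 ∣_) (+-comm 1 (2 * h)) 2∣) (m∣m*n h))) λ ()

oddPrime⇒2∣p∸1 : ∀ {p} → Prime p → 2 < p → 2 ∣ p ∸ 1
oddPrime⇒2∣p∸1 {p} pr 2<p with even⊎odd p
... | inj₁ (h , refl) = contradiction (prime∣prime⇒≡ prime[2] pr (m∣m*n h)) (<⇒≢ 2<p)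
... | inj₂ (h , refl) = m∣m*n h

factorOut : ∀ {p} → Prime p → ∀ n → 1 ≤ n → p ∣ n → ∃[ e ] ∃[ z ] (n ≡ p ^ suc e * z × p ∤ z × 1 ≤ z)
factorOut {p} pr = <-rec _ λ n rec 1≤n p∣n → go n rec 1≤n p∣n
  where
  go : ∀ n → (∀ {m} → m < n → 1 ≤ m → p ∣ m → ∃[ e ] ∃[ z ] (m ≡ p ^ suc e * z × p ∤ z × 1 ≤ z)) →
       1 ≤ n → p ∣ n → ∃[ e ] ∃[ z ] (n ≡ p ^ suc e * z × p ∤ z × 1 ≤ z)
  go n rec 1≤n (divides (suc m-1) refl) with p ∣? suc m-1
  ... | no p∤m = 0 , suc m-1 , trans (*-comm (suc m-1) p) (cong (_* suc m-1) (sym (*-identityʳ p))) , p∤m , s≤s z≤n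
  ... | yes p∣m with rec (m<m*n (suc m-1) p (prime>1 pr)) (s≤s z≤n) p∣m
  ...   | e , z , m≡ , p∤z , 1≤z = suc e , z ,
          trans (*-comm (suc m-1) p) (trans (cong (p *_) m≡) (sym (*-assoc p (p ^ suc e) z))) , p∤z , 1≤z

-- Odd primes are split off in no particular order, and any power of 2 stays in `z`. The exponent is
-- `suc e` so that `φ-^*` applies directly.
data OddPrimePart (y : ℕ) : Set where
  pow₂  : ∀ e → y ≡ 2 ^ e → OddPrimePart y
  split : ∀ p e z → Prime p → 2 < p → y ≡ p ^ suc e * z → p ∤ z → 1 ≤ z → OddPrimePart y

pow₂⊎odd∣ : ∀ n → 1 ≤ n → (∃[ e ] n ≡ 2 ^ e) ⊎ (∃[ p ] (Prime p × 2 < p × p ∣ n))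
pow₂⊎odd∣ n 1≤n = subst Dichotomy (sym isFactorisation) (go factorsPrime)
  where
  open PrimeFactorisation (factorise n {{>-nonZero 1≤n}})
  Dichotomy : ℕ → Set
  Dichotomy m = (∃[ e ] m ≡ 2 ^ e) ⊎ (∃[ p ] (Prime p × 2 < p × p ∣ m))
  go : ∀ {ps} → All Prime ps → Dichotomy (product ps)
  go [] = inj₁ (0 , refl)
  go {p ∷ ps} (pr ∷ prs) with p ≟ 2
  ... | no p≢2 = inj₂ (p , pr , ≤∧≢⇒< (prime>1 pr) (p≢2 ∘ sym) , m∣m*n (product ps))
  ... | yes refl with go prs
  ...   | inj₁ (e , eq) = inj₁ (suc e , cong (2 *_) eq)
  ...   | inj₂ (q , qr , 2<q , q∣) = inj₂ (q , qr , 2<q , ∣n⇒∣m*n 2 q∣)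

oddPrimePart : ∀ y → 1 ≤ y → OddPrimePart y
oddPrimePart y 1≤y with pow₂⊎odd∣ y 1≤y
... | inj₁ (e , eq) = pow₂ e eq
... | inj₂ (p , pr , 2<p , p∣y) with factorOut pr y 1≤y p∣y
...   | e , z , eq , p∤z , 1≤z = split p e z pr 2<p eq p∤z 1≤z

-- Either `z` is 2^e with e ≥ 2, and φ is 2^(e - 1), or an odd prime p divides `z` and contributes
-- the even factor p - 1.
2∣φ : ∀ z → 3 ≤ z → 2 ∣ φ z
2∣φ z 3≤z with oddPrimePart z (≤-trans (s≤s z≤n) 3≤z)
... | pow₂ 0 refl = contradiction 3≤z λ { (s≤s ()) }
... | pow₂ 1 refl = contradiction 3≤z λ { (s≤s (s≤s ())) }
... | pow₂ (suc (suc e)) refl = subst (2 ∣_) (sym (φ-2^ (suc e))) (m∣m*n (2 ^ e))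
... | split p e z′ pr 2<p refl p∤z′ _ = subst (2 ∣_) (sym (φ-^* e pr p∤z′))
        (∣m⇒∣m*n (φ z′) (∣n⇒∣m*n (p ^ e) (oddPrime⇒2∣p∸1 pr 2<p)))

2∤φ⇒1⊎2 : ∀ z → 1 ≤ z → 2 ∤ φ z → z ≡ 1 ⊎ z ≡ 2
2∤φ⇒1⊎2 1 _ _ = inj₁ refl
2∤φ⇒1⊎2 2 _ _ = inj₂ refl
2∤φ⇒1⊎2 (suc (suc (suc z))) _ 2∤ = contradiction (2∣φ (suc (suc (suc z))) (s≤s (s≤s (s≤s z≤n)))) 2∤

-- The equation φ(y) = q^r (q - 1) for q ≡ 3 modulo 4

module _ {q : ℕ} (pr : Prime q) (q%4≡3 : q % 4 ≡ 3) where

  private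
    q≡ : q ≡ 3 + q / 4 * 4
    q≡ = trans (m≡m%n+[m/n]*n q 4) (cong (_+ q / 4 * 4) q%4≡3)

  3≤q : 3 ≤ q
  3≤q = subst (_≤ q) q%4≡3 (m%n≤m q 4)

  2∤q : 2 ∤ q
  2∤q 2∣q = <⇒≢ 3≤q (prime∣prime⇒≡ prime[2] pr 2∣q)

  4∤q^r*[q∸1] : ∀ r → 4 ∤ q ^ r * (q ∸ 1)
  4∤q^r*[q∸1] r 4∣ =
    [ 2∤q ∘ prime∣^⇒∣ r prime[2] , 2∤odd (q / 4) ]′
    (euclidsLemma (q ^ r) h prime[2] (*-cancelˡ-∣ {m = 2} {n = q ^ r * h} 2 (subst (4 ∣_) regroup 4∣)))
    where
    -- As q = 3 + 4c, half of q - 1 is the odd number 2c + 1.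
    h = suc (2 * (q / 4))
    double : ∀ c → 2 + c * 4 ≡ 2 * suc (2 * c)
    double c = trans (cong (2 +_) (trans (*-comm c 4) (*-assoc 2 2 c))) (sym (*-suc 2 (2 * c)))
    regroup : q ^ r * (q ∸ 1) ≡ 2 * (q ^ r * h)
    regroup = begin
      q ^ r * (q ∸ 1)  ≡⟨ cong (q ^ r *_) (trans (cong (_∸ 1) q≡) (double (q / 4))) ⟩
      q ^ r * (2 * h)  ≡⟨ *-assoc (q ^ r) 2 h ⟨
      q ^ r * 2 * h    ≡⟨ cong (_* h) (*-comm (q ^ r) 2) ⟩
      2 * q ^ r * h    ≡⟨ *-assoc 2 (q ^ r) h ⟩
      2 * (q ^ r * h)  ∎
      where open ≡-Reasoning

  φ-q^ : ∀ r → φ (q ^ (r + 1)) ≡ q ^ r * (q ∸ 1)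
  φ-q^ r = trans (cong (λ s → φ (q ^ s)) (+-comm r 1)) (φ-^ r pr)

  φ-K : ∀ r → φ (K q r) ≡ q ^ r * (q ∸ 1)
  φ-K r = trans (φ-∤ prime[2] λ 2∣ → 2∤q (prime∣^⇒∣ (r + 1) prime[2] 2∣)) (trans (+-identityʳ _) (φ-q^ r))

  -- The difference of q^(r+1) and q^r (q - 1) is q^r ≥ 1. Thus the candidate `m + 1`, when prime,
  -- never exceeds the candidate `q ^ (r + 1)`.
  m+1≤q^[r+1] : ∀ r → q ^ r * (q ∸ 1) + 1 ≤ q ^ (r + 1)
  m+1≤q^[r+1] r = begin
    q ^ r * (q ∸ 1) + 1          ≤⟨ +-monoʳ-≤ (q ^ r * (q ∸ 1)) (m^n>0 q {{prime⇒nonZero pr}} r) ⟩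
    q ^ r * (q ∸ 1) + q ^ r      ≡⟨ +-comm _ (q ^ r) ⟩
    q ^ r + q ^ r * (q ∸ 1)      ≡⟨ *-suc (q ^ r) (q ∸ 1) ⟨
    q ^ r * suc (q ∸ 1)          ≡⟨ cong (q ^ r *_) (m+[n∸m]≡n (≤-trans (s≤s z≤n) 3≤q)) ⟩
    q ^ r * q                    ≡⟨ *-comm (q ^ r) q ⟩
    q * q ^ r                    ≡⟨ cong (q ^_) (+-comm 1 r) ⟩
    q ^ (r + 1)                  ∎
    where open ≤-Reasoning

  -- As φ(y) is twice an odd number, y is p^e or 2p^e for an odd prime p.
  φ⁻¹-q^r[q∸1] : ∀ {r y} → 1 ≤ r → 1 ≤ y → φ y ≡ q ^ r * (q ∸ 1) →
    ∃[ z ] (1 ≤ z × z ≤ 2 ×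
      ((Prime (q ^ r * (q ∸ 1) + 1) × y ≡ (q ^ r * (q ∸ 1) + 1) * z) ⊎ y ≡ q ^ (r + 1) * z))
  φ⁻¹-q^r[q∸1] {r@(suc r-1)} {y} 1≤r 1≤y φy≡m with oddPrimePart y 1≤y
  -- As `1 ≤ r`, the odd prime `q` divides `φ y`, which is impossible when `y` is a power of 2.
  ... | pow₂ zero refl =
          contradiction (subst (q ∣_) (sym φy≡m) (∣m⇒∣m*n (q ∸ 1) (m∣m*n (q ^ r-1)))) (∤1 pr)
  ... | pow₂ (suc e) refl = contradiction
          (prime∣prime⇒≡ pr prime[2] (prime∣^⇒∣ e pr (subst (q ∣_) (trans (sym φy≡m) (φ-2^ e)) (∣m⇒∣m*n (q ∸ 1) (m∣m*n (q ^ r-1))))))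
          (<⇒≢ 3≤q ∘ sym)
  ... | split p e z pp 2<p refl p∤z 1≤z = z , 1≤z , z≤2 , cases e p^e[p∸1]≡m
    where
    m = q ^ r * (q ∸ 1)

    φ≡ : p ^ e * (p ∸ 1) * φ z ≡ m
    φ≡ = trans (sym (φ-^* e pp p∤z)) φy≡m

    -- The even factor `p ∸ 1` uses up the single 2 in `m`, so `φ z` must be odd.
    z≡1⊎z≡2 : z ≡ 1 ⊎ z ≡ 2
    z≡1⊎z≡2 = 2∤φ⇒1⊎2 z 1≤z λ 2∣φz → 4∤q^r*[q∸1] r
      (subst (4 ∣_) φ≡ (*-pres-∣ (∣n⇒∣m*n (p ^ e) (oddPrime⇒2∣p∸1 pp 2<p)) 2∣φz))

    z≤2 : z ≤ 2
    z≤2 = [ (λ { refl → s≤s z≤n }) , ≤-reflexive ]′ z≡1⊎z≡2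

    φz≡1 : φ z ≡ 1
    φz≡1 = [ (λ { refl → refl }) , (λ { refl → refl }) ]′ z≡1⊎z≡2

    p^e[p∸1]≡m : p ^ e * (p ∸ 1) ≡ m
    p^e[p∸1]≡m = trans (trans (sym (*-identityʳ _)) (cong (p ^ e * (p ∸ 1) *_) (sym φz≡1))) φ≡

    p∸1<p : p ∸ 1 < p
    p∸1<p = ∸-monoʳ-< (s≤s z≤n) (<⇒≤ (prime>1 pp))

    q∸1<q : q ∸ 1 < q
    q∸1<q = ∸-monoʳ-< (s≤s z≤n) (<⇒≤ (prime>1 pr))

    cases : ∀ e → p ^ e * (p ∸ 1) ≡ m →
      (Prime (m + 1) × p ^ suc e * z ≡ (m + 1) * z) ⊎ p ^ suc e * z ≡ q ^ (r + 1) * z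
    cases zero eq = inj₁ (subst Prime p≡ pp , cong (_* z) (trans (*-identityʳ p) p≡))
      where
      p≡ : p ≡ m + 1
      p≡ = trans (sym (m∸n+n≡m (<⇒≤ (prime>1 pp)))) (cong (_+ 1) (trans (sym (+-identityʳ (p ∸ 1))) eq))
    cases (suc e) eq with euclidsLemma (q ^ r) (q ∸ 1) pp (subst (p ∣_) eq (∣m⇒∣m*n (p ∸ 1) (m∣m*n (p ^ e))))
    ... | inj₁ p∣q^r = inj₂ (cong (_* z) (same (prime∣prime⇒≡ pp pr (prime∣^⇒∣ r pp p∣q^r)) eq))
      where
      same : p ≡ q → p ^ suc e * (p ∸ 1) ≡ m → p ^ suc (suc e) ≡ q ^ (r + 1)
      same refl eq′ = trans (cong (q *_) (*-cancelʳ-≡ (q ^ suc e) (q ^ r) (q ∸ 1) {{>-nonZero (m<n⇒0<n∸m (prime>1 pr))}} eq′))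
                        (cong (q ^_) (+-comm 1 r))
    -- Here p < q, whereas q divides p^(e+1) (p - 1) and hence is at most p.
    ... | inj₂ p∣q∸1 = contradiction q≤p (<⇒≱ (≤-<-trans (∣⇒≤ {{>-nonZero (m<n⇒0<n∸m (prime>1 pr))}} p∣q∸1) q∸1<q))
      where
      q≤p : q ≤ p
      q≤p with euclidsLemma (p ^ suc e) (p ∸ 1) pr (subst (q ∣_) (sym eq) (∣m⇒∣m*n (q ∸ 1) (m∣m*n (q ^ r-1))))
      ... | inj₁ q∣p^ = ∣⇒≤ {{prime⇒nonZero pp}} (prime∣^⇒∣ (suc e) pr q∣p^)
      ... | inj₂ q∣p∸1 = ≤-trans (∣⇒≤ {{>-nonZero (m<n⇒0<n∸m (prime>1 pp))}} q∣p∸1) (<⇒≤ p∸1<p)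

-- The families 𝒦max and 𝒦min

n<2^n : ∀ n → n < 2 ^ n
n<2^n zero    = s≤s z≤n
n<2^n (suc n) = +-mono-≤-< (m^n>0 2 n) (subst (n <_) (sym (+-identityʳ (2 ^ n))) (n<2^n n))

n≤b^n : ∀ {b} n → 2 ≤ b → n ≤ b ^ n
n≤b^n n 2≤b = ≤-trans (<⇒≤ (n<2^n n)) (^-monoˡ-≤ n 2≤b)

-- The ratio is 2q/(q - 1), and q ≤ 2(q - 1).
K≤4φ : ∀ {q} → Prime q → q % 4 ≡ 3 → ∀ r → K q r ≤ 4 * φ (K q r)
K≤4φ {q} pr q%4≡3 r = begin
  2 * q ^ (r + 1)                ≡⟨ cong (λ s → 2 * q ^ s) (+-comm r 1) ⟩
  2 * (q * q ^ r)                ≤⟨ *-monoʳ-≤ 2 (*-monoˡ-≤ (q ^ r) (q≤2[q∸1] (3≤q pr q%4≡3))) ⟩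
  2 * (2 * (q ∸ 1) * q ^ r)      ≡⟨ regroup (q ∸ 1) (q ^ r) ⟩
  4 * (q ^ r * (q ∸ 1))          ≡⟨ cong (4 *_) (φ-K pr q%4≡3 r) ⟨
  4 * φ (K q r)                  ∎
  where
  open ≤-Reasoning
  q≤2[q∸1] : ∀ {q} → 3 ≤ q → q ≤ 2 * (q ∸ 1)
  q≤2[q∸1] {suc (suc q)} (s≤s (s≤s 1≤q)) = subst (_≤ suc q + suc (q + 0)) (+-comm (suc q) 1) (+-monoʳ-≤ (suc q) (s≤s z≤n))
  regroup : ∀ a b → 2 * (2 * a * b) ≡ 4 * (b * a)
  regroup = solve-∀

-- All preimages are `(m + 1) * z` or `q ^ (r + 1) * z` with `z ≤ 2`, and `m + 1 ≤ q ^ (r + 1)`.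
𝒦max⊆N₂ : 𝒦max ⊆ N₂
𝒦max⊆N₂ x (q , r , pr , q%4≡3 , 1≤r , refl) =
  m , (K q r , 1≤K , φ-K pr q%4≡3 r) , (1≤K , φ-K pr q%4≡3 r) , max
  where
  m = q ^ r * (q ∸ 1)

  1≤K : 1 ≤ K q r
  1≤K = *-mono-≤ {1} {2} (s≤s z≤n) (m^n>0 q {{prime⇒nonZero pr}} (r + 1))

  max : ∀ y → InPhiInv m y → y ≤ K q r
  max y (1≤y , φy≡m) with φ⁻¹-q^r[q∸1] pr q%4≡3 1≤r 1≤y φy≡m
  ... | z , _ , z≤2 , inj₁ (_ , refl) =
        ≤-trans (*-mono-≤ (m+1≤q^[r+1] pr q%4≡3 r) z≤2) (≤-reflexive (*-comm (q ^ (r + 1)) 2))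
  ... | z , _ , z≤2 , inj₂ refl =
        ≤-trans (*-monoʳ-≤ (q ^ (r + 1)) z≤2) (≤-reflexive (*-comm (q ^ (r + 1)) 2))

𝒦max-infinite : Infinite 𝒦max
𝒦max-infinite n = K 3 (suc n) , (3 , suc n , prime[3] , refl , s≤s z≤n , refl) ,
  ≤-trans (m≤n+m n 2) (≤-trans (≤-reflexive (cong suc (+-comm 1 n)))
    (≤-trans (n≤b^n (suc n + 1) (s≤s (s≤s z≤n))) (m≤m+n _ _)))

𝒦max∩N₁-finite : FinitelyManyOf 𝒦max N₁
𝒦max∩N₁-finite = 2310 , λ { x (q , r , pr , q%4≡3 , 1≤r , refl) → N₁⇒<2310 (K≤4φ pr q%4≡3 r) }

-- The same list of preimages, now with `z ≥ 1`: the least is `m + 1` if this is prime; otherwise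
-- only the multiples of `q ^ (r + 1)` remain.
𝒦min⊆N₃ : 𝒦min ⊆ N₃
𝒦min⊆N₃ x (q , r , pr , q%4≡3 , 1≤r , isk) = m , (x , φx≡m isk) , φx≡m isk , min isk
  where
  m = q ^ r * (q ∸ 1)

  φx≡m : ∀ {x} → Isk q r x → InPhiInv m x
  φx≡m (inj₁ (m+1-prime , refl)) = m≤n+m 1 m , trans (trans (cong φ (sym (*-identityʳ (m + 1))))
    (trans (φ-∤ m+1-prime (∤1 m+1-prime)) (*-identityʳ (m + 1 ∸ 1)))) (m+n∸n≡m m 1)
  φx≡m (inj₂ (_ , refl)) = m^n>0 q {{prime⇒nonZero pr}} (r + 1) , φ-q^ pr q%4≡3 r

  min : ∀ {x} → Isk q r x → ∀ y → InPhiInv m y → x ≤ y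
  min isk y (1≤y , φy≡m) with φ⁻¹-q^r[q∸1] pr q%4≡3 1≤r 1≤y φy≡m
  min (inj₁ (_ , refl)) _ _ | z , 1≤z , _ , inj₁ (_ , refl) = m≤m*n (m + 1) z {{>-nonZero 1≤z}}
  min (inj₂ (¬prime , _)) _ _ | z , 1≤z , _ , inj₁ (m+1-prime , _) = contradiction m+1-prime ¬prime
  min (inj₁ (_ , refl)) _ _ | z , 1≤z , _ , inj₂ refl =
    ≤-trans (m+1≤q^[r+1] pr q%4≡3 r) (m≤m*n (q ^ (r + 1)) z {{>-nonZero 1≤z}})
  min (inj₂ (_ , refl)) _ _ | z , 1≤z , _ , inj₂ refl = m≤m*n (q ^ (r + 1)) z {{>-nonZero 1≤z}}

-- 2·3³ + 1 = 55, and 3⁴ ≡ 1 modulo 5.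
5∣3^[4n+3]*2+1 : ∀ n → 5 ∣ 3 ^ (n * 4 + 3) * 2 + 1
5∣3^[4n+3]*2+1 zero    = divides 11 refl
5∣3^[4n+3]*2+1 (suc n) = subst (5 ∣_) (sym (step (3 ^ (n * 4 + 3))))
  (∣m∣n⇒∣m+n (∣m⇒∣m*n (3 ^ (n * 4 + 3)) (divides 32 refl)) (5∣3^[4n+3]*2+1 n))
  where
  step : ∀ c → 3 * (3 * (3 * (3 * c))) * 2 + 1 ≡ 160 * c + (c * 2 + 1)
  step = solve-∀

-- For q = 3 and r ≡ 3 modulo 4 the candidate prime 2 · 3^r + 1 is divisible by 5, so the element is
-- the proper power 3^(r+1).
𝒦min∩Composite-infinite : InfinitelyManyOf 𝒦min Composite
𝒦min∩Composite-infinite n =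
  3 ^ (r + 1) , (3 , r , prime[3] , refl , ≤-trans (s≤s z≤n) (m≤n+m 3 (n * 4)) , inj₂ (¬prime , refl)) ,
  isComposite , ≤-trans n≤r+1 (n≤b^n (r + 1) (s≤s (s≤s z≤n)))
  where
  r = n * 4 + 3

  n≤r+1 : n ≤ r + 1
  n≤r+1 = ≤-trans (m≤m*n n 4) (≤-trans (m≤m+n (n * 4) 3) (m≤m+n r 1))

  27≤3^r : 27 ≤ 3 ^ r
  27≤3^r = ^-monoʳ-≤ 3 (m≤n+m 3 (n * 4))

  -- From `27 ≤ 3 ^ r` the number is at least 55, so it is not 5 itself.
  ¬prime : ¬ Prime (3 ^ r * (3 ∸ 1) + 1)
  ¬prime pr = <⇒≢ (≤-trans (m≤m+n 6 49) (+-monoˡ-≤ 1 (*-monoˡ-≤ 2 27≤3^r)))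
    (prime∣prime⇒≡ prime[5] pr (5∣3^[4n+3]*2+1 n))

  isComposite : Composite (3 ^ (r + 1))
  isComposite = composite-≢ 3 {{_}} {{m^n≢0 3 (r + 1)}}
    (<⇒≢ (≤-trans (m≤m+n 4 23) (≤-trans 27≤3^r (^-monoʳ-≤ 3 (m≤m+n r 1)))))
    (subst (λ s → 3 ∣ 3 ^ s) (+-comm 1 r) (m∣m*n (3 ^ r)))

𝒦min-infinite : Infinite 𝒦min
𝒦min-infinite n with 𝒦min∩Composite-infinite n
... | x , x∈𝒦min , _ , n≤x = x , x∈𝒦min , n≤x

-- The family ℛ

-- y/φ(y) ≤ c/d.
record Ratio≤ (c d y : ℕ) : Set where
  constructor ratio
  field
    d*y≤c*φy : d * y ≤ c * φ y

open Ratio≤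

ratio-pow₂ : ∀ e → Ratio≤ 2 1 (2 ^ e)
ratio-pow₂ zero    = ratio (s≤s z≤n)
ratio-pow₂ (suc e) = ratio (≤-reflexive (trans (*-identityˡ (2 ^ suc e)) (cong (2 *_) (sym (φ-2^ e)))))

-- The prime `p` contributes p/(p - 1), whatever its exponent, and this is at most (b + 1)/b once p
-- ≥ b + 1.
ratio-split : ∀ {p z c d} b e → Prime p → p ∤ z → suc b ≤ p → Ratio≤ c d z → Ratio≤ (suc b * c) (b * d) (p ^ suc e * z)
ratio-split {p@(suc p-1)} {z} {c} {d} b e pr p∤z (s≤s b≤p-1) r = ratio (begin
  b * d * (p * p ^ e * z)                  ≡⟨ regroup₁ b d p (p ^ e) z ⟩
  b * p * p ^ e * (d * z)                  ≤⟨ *-mono-≤ (*-monoˡ-≤ (p ^ e) bp≤[b+1][p∸1]) (d*y≤c*φy r) ⟩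
  suc b * p-1 * p ^ e * (c * φ z)          ≡⟨ regroup₂ (suc b) p-1 (p ^ e) c (φ z) ⟩
  suc b * c * (p ^ e * p-1 * φ z)          ≡⟨ cong (suc b * c *_) (φ-^* e pr p∤z) ⟨
  suc b * c * φ (p * p ^ e * z)            ∎)
  where
  open ≤-Reasoning
  regroup₁ : ∀ b d p P z → b * d * (p * P * z) ≡ b * p * P * (d * z)
  regroup₁ = solve-∀
  regroup₂ : ∀ B p P c f → B * p * P * (c * f) ≡ B * c * (P * p * f)
  regroup₂ = solve-∀
  bp≤[b+1][p∸1] : b * suc p-1 ≤ suc b * p-1
  bp≤[b+1][p∸1] = subst (_≤ suc b * p-1) (sym (*-suc b p-1)) (+-monoˡ-≤ (b * p-1) b≤p-1)

ratio-weaken : ∀ {c d y} c′ d′ .{{_ : NonZero d}} → d′ * c ≤ c′ * d → Ratio≤ c d y → Ratio≤ c′ d′ y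
ratio-weaken {c} {d} {y} c′ d′ d′c≤c′d r = ratio (*-cancelˡ-≤ d (begin
  d * (d′ * y)      ≡⟨ swap d d′ y ⟩
  d′ * (d * y)      ≤⟨ *-monoʳ-≤ d′ (d*y≤c*φy r) ⟩
  d′ * (c * φ y)    ≡⟨ *-assoc d′ c (φ y) ⟨
  d′ * c * φ y      ≤⟨ *-monoˡ-≤ (φ y) d′c≤c′d ⟩
  c′ * d * φ y      ≡⟨ cong (_* φ y) (*-comm c′ d) ⟩
  d * c′ * φ y      ≡⟨ *-assoc d c′ (φ y) ⟩
  d * (c′ * φ y)    ∎))
  where
  open ≤-Reasoning
  swap : ∀ a b c → a * (b * c) ≡ b * (a * c)
  swap = solve-∀

-- Odd primes of y when 16 ∤ φ(y)

∤-* : ∀ {p m n} → Prime p → p ∤ m → p ∤ n → p ∤ m * n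
∤-* {m = m} {n} pr p∤m p∤n p∣mn = [ p∤m , p∤n ]′ (euclidsLemma m n pr p∣mn)

∤-^ : ∀ {p a} n → Prime p → p ∤ a → p ∤ a ^ n
∤-^ n pr p∤a = p∤a ∘ prime∣^⇒∣ n pr

4∤p∸1⇒p≡3[4] : ∀ {p} → Prime p → 2 < p → 4 ∤ p ∸ 1 → ∃[ c ] p ≡ 3 + c * 4
4∤p∸1⇒p≡3[4] {p} pr 2<p 4∤p∸1 with oddPrime⇒2∣p∸1 pr 2<p
... | divides h p∸1≡h*2 with even⊎odd h
...   | inj₁ (c , refl) = contradiction (divides c (trans p∸1≡h*2 (regroup c))) 4∤p∸1
  where
  regroup : ∀ c → 2 * c * 2 ≡ c * 4
  regroup = solve-∀
...   | inj₂ (c , refl) = c , trans (sym (m+[n∸m]≡n (<⇒≤ (prime>1 pr)))) (trans (cong suc p∸1≡h*2) (regroup c))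
  where
  regroup : ∀ c → suc (suc (2 * c) * 2) ≡ 3 + c * 4
  regroup = solve-∀

oddPrime≢3⇒5≤ : ∀ {p} → Prime p → 2 < p → p ≢ 3 → 5 ≤ p
oddPrime≢3⇒5≤ {p} pr 2<p p≢3 = ≤∧≢⇒< (≤∧≢⇒< 2<p (p≢3 ∘ sym)) λ { refl → from-no (prime? 4) pr }

≡3[4]∧≢3⇒7≤ : ∀ {p} → ∃[ c ] p ≡ 3 + c * 4 → p ≢ 3 → 7 ≤ p
≡3[4]∧≢3⇒7≤ (0 , refl)     p≢3 = contradiction refl p≢3
≡3[4]∧≢3⇒7≤ (suc c , refl) p≢3 = m≤m+n 7 (c * 4)

≡3[4]∧≢3,7⇒11≤ : ∀ {p} → ∃[ c ] p ≡ 3 + c * 4 → p ≢ 3 → p ≢ 7 → 11 ≤ p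
≡3[4]∧≢3,7⇒11≤ (0 , refl)           p≢3 p≢7 = contradiction refl p≢3
≡3[4]∧≢3,7⇒11≤ (1 , refl)           p≢3 p≢7 = contradiction refl p≢7
≡3[4]∧≢3,7⇒11≤ (suc (suc c) , refl) p≢3 p≢7 = m≤m+n 11 (c * 4)

-- The bound 15 is just enough: 2 · 3/2 · 7/6 · 15/14 = 15/4.
≡3[4]∧≢3,7,11⇒15≤ : ∀ {p} → ∃[ c ] p ≡ 3 + c * 4 → p ≢ 3 → p ≢ 7 → p ≢ 11 → 15 ≤ p
≡3[4]∧≢3,7,11⇒15≤ (0 , refl)                 p≢3 p≢7 p≢11 = contradiction refl p≢3
≡3[4]∧≢3,7,11⇒15≤ (1 , refl)                 p≢3 p≢7 p≢11 = contradiction refl p≢7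
≡3[4]∧≢3,7,11⇒15≤ (2 , refl)                 p≢3 p≢7 p≢11 = contradiction refl p≢11
≡3[4]∧≢3,7,11⇒15≤ (suc (suc (suc c)) , refl) p≢3 p≢7 p≢11 = m≤m+n 15 (c * 4)

-- This is φ(p^(e+1)) for a prime p, the exponent being shifted as in `OddPrimePart`.
φ-factor : ℕ → ℕ → ℕ
φ-factor p e = p ^ e * (p ∸ 1)

module _ {p₁ p₂ p₃ : ℕ} (z e₁ e₂ e₃ : ℕ)
  (pr₁ : Prime p₁) (2<p₁ : 2 < p₁) (pr₂ : Prime p₂) (2<p₂ : 2 < p₂) (pr₃ : Prime p₃) (2<p₃ : 2 < p₃)
  (16∤ : 16 ∤ φ-factor p₁ e₁ * (φ-factor p₂ e₂ * (φ-factor p₃ e₃ * φ z)))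
  where

  private
    ∣φ-factor : ∀ {d p} e → d ∣ p ∸ 1 → d ∣ φ-factor p e
    ∣φ-factor {p = p} e = ∣n⇒∣m*n (p ^ e)

    2∣₁ : 2 ∣ φ-factor p₁ e₁
    2∣₁ = ∣φ-factor e₁ (oddPrime⇒2∣p∸1 pr₁ 2<p₁)
    2∣₂ : 2 ∣ φ-factor p₂ e₂
    2∣₂ = ∣φ-factor e₂ (oddPrime⇒2∣p∸1 pr₂ 2<p₂)
    2∣₃ : 2 ∣ φ-factor p₃ e₃
    2∣₃ = ∣φ-factor e₃ (oddPrime⇒2∣p∸1 pr₃ 2<p₃)

  -- Three odd primes already account for a factor 8, so none of them can contribute a second 2.
  first≡3[4] : ∃[ c ] p₁ ≡ 3 + c * 4
  first≡3[4] = 4∤p∸1⇒p≡3[4] pr₁ 2<p₁ λ 4∣ →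
    16∤ (*-pres-∣ (∣φ-factor e₁ 4∣) (*-pres-∣ 2∣₂ (∣m⇒∣m*n (φ z) 2∣₃)))

  second≡3[4] : ∃[ c ] p₂ ≡ 3 + c * 4
  second≡3[4] = 4∤p∸1⇒p≡3[4] pr₂ 2<p₂ λ 4∣ →
    16∤ (*-pres-∣ 2∣₁ (*-pres-∣ (∣φ-factor e₂ 4∣) (∣m⇒∣m*n (φ z) 2∣₃)))

  third≡3[4] : ∃[ c ] p₃ ≡ 3 + c * 4
  third≡3[4] = 4∤p∸1⇒p≡3[4] pr₃ 2<p₃ λ 4∣ →
    16∤ (*-pres-∣ 2∣₁ (*-pres-∣ 2∣₂ (∣m⇒∣m*n (φ z) (∣φ-factor e₃ 4∣))))

  -- The factor 8 from the three primes leaves `φ z` odd; in particular there is no fourth odd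
  -- prime.
  cofactor : 1 ≤ z → z ≡ 1 ⊎ z ≡ 2
  cofactor 1≤z = 2∤φ⇒1⊎2 z 1≤z λ 2∣φz →
    16∤ (*-pres-∣ 2∣₁ (*-pres-∣ 2∣₂ (*-pres-∣ 2∣₃ 2∣φz)))

  ratio-cofactor : 1 ≤ z → Ratio≤ 2 1 z
  ratio-cofactor 1≤z with cofactor 1≤z
  ... | inj₁ refl = ratio (s≤s z≤n)
  ... | inj₂ refl = ratio (s≤s (s≤s z≤n))

∤⇒≢factor : ∀ {p q y} e z → p ∤ y → y ≡ q ^ suc e * z → q ≢ p
∤⇒≢factor {q = q} e z p∤y refl refl = p∤y (∣m⇒∣m*n z (m∣m*n (q ^ e)))

∤⇒∤cofactor : ∀ {p y} q e z → p ∤ y → y ≡ q ^ suc e * z → p ∤ z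
∤⇒∤cofactor q e z p∤y refl p∣z = p∤y (∣n⇒∣m*n (q ^ suc e) p∣z)

-- The only source of a 5 is 11 - 1 = 10, and it supplies just one.
25∤φ-3,7,11 : ∀ e₁ e₂ e₃ {z} → z ≡ 1 ⊎ z ≡ 2 →
  25 ∤ φ-factor 3 e₁ * (φ-factor 7 e₂ * (φ-factor 11 e₃ * φ z))
25∤φ-3,7,11 e₁ e₂ e₃ {z} z≡1⊎z≡2 25∣ =
  ∤-* prime[5] (∤-* prime[5] (∤-^ e₁ prime[5] (5∤ 3)) (5∤ 2))
    (∤-* prime[5] (∤-* prime[5] (∤-^ e₂ prime[5] (5∤ 7)) (5∤ 6))
      (∤-* prime[5] (∤-^ e₃ prime[5] (5∤ 11)) (5∤ 2)))
    (*-cancelˡ-∣ {m = 5} {n = 3 ^ e₁ * 2 * (7 ^ e₂ * 6 * (11 ^ e₃ * 2))} 5 (subst (25 ∣_) regroup 25∣))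
  where
  5∤ : ∀ n {ok : False (5 ∣? n)} → 5 ∤ n
  5∤ n {ok} = toWitnessFalse ok
  φz≡1 : φ z ≡ 1
  φz≡1 = [ (λ { refl → refl }) , (λ { refl → refl }) ]′ z≡1⊎z≡2
  move : ∀ a b c → a * 2 * (b * 6 * (c * 10 * 1)) ≡ 5 * (a * 2 * (b * 6 * (c * 2)))
  move = solve-∀
  regroup : φ-factor 3 e₁ * (φ-factor 7 e₂ * (φ-factor 11 e₃ * φ z)) ≡ 5 * (3 ^ e₁ * 2 * (7 ^ e₂ * 6 * (11 ^ e₃ * 2)))
  regroup = trans (cong (λ k → φ-factor 3 e₁ * (φ-factor 7 e₂ * (φ-factor 11 e₃ * k))) φz≡1)
    (move (3 ^ e₁) (7 ^ e₂) (11 ^ e₃))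

module _ {y : ℕ} (1≤y : 1 ≤ y) (16∤φy : 16 ∤ φ y) (25∣φy : 25 ∣ φ y) where

  private
    φ-split : ∀ {p z y} e → Prime p → p ∤ z → y ≡ p ^ suc e * z → φ y ≡ φ-factor p e * φ z
    φ-split e pr p∤z refl = φ-^* e pr p∤z

    ratio≤ : ∀ {c d y z} p b e → Prime p → p ∤ z → suc b ≤ p → y ≡ p ^ suc e * z → Ratio≤ c d z → Ratio≤ (suc b * c) (b * d) y
    ratio≤ p b e pr p∤z b<p refl = ratio-split b e pr p∤z b<p

    ratio-2^ : ∀ {y} e → y ≡ 2 ^ e → Ratio≤ 2 1 y
    ratio-2^ e refl = ratio-pow₂ e

    φ-split₃ : ∀ z₁ z₂ z₃ p₁ e₁ p₂ e₂ p₃ e₃ →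
      φ y ≡ φ-factor p₁ e₁ * φ z₁ → φ z₁ ≡ φ-factor p₂ e₂ * φ z₂ → φ z₂ ≡ φ-factor p₃ e₃ * φ z₃ →
      φ y ≡ φ-factor p₁ e₁ * (φ-factor p₂ e₂ * (φ-factor p₃ e₃ * φ z₃))
    φ-split₃ z₁ z₂ z₃ p₁ e₁ p₂ e₂ p₃ e₃ eq₁ eq₂ eq₃ =
      trans eq₁ (cong (φ-factor p₁ e₁ *_) (trans eq₂ (cong (φ-factor p₂ e₂ *_) eq₃)))

    weaken : ∀ {c d y} .{{_ : NonZero d}} → {ok : True (4 * c ≤? 15 * d)} → Ratio≤ c d y → Ratio≤ 15 4 y
    weaken {ok = ok} = ratio-weaken 15 4 (toWitness ok)

  -- 16 ∤ φ(y) leaves at most three odd primes p | y, and if there are three, each is 3 modulo 4.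
  -- The ratio then exceeds 15/4 only for {3, 7, 11}, where 25 ∤ φ(y).
  ratio≤15/4 : Ratio≤ 15 4 y
  ratio≤15/4 with 3 ∣? y
  ratio≤15/4 | yes 3∣y with factorOut prime[3] y 1≤y 3∣y
  -- Next to 3, the prime 7 needs its own case: without it, any two further odd primes are at least
  -- 11.
  ... | e₁ , z₁ , y≡ , 3∤z₁ , 1≤z₁ with 7 ∣? z₁
  ratio≤15/4 | yes 3∣y | e₁ , z₁ , y≡ , 3∤z₁ , 1≤z₁ | yes 7∣z₁ with factorOut prime[7] z₁ 1≤z₁ 7∣z₁
  ... | e₂ , z₂ , z₁≡ , 7∤z₂ , 1≤z₂ with oddPrimePart z₂ 1≤z₂
  ... | pow₂ e z₂≡ = weaken (ratio≤ 3 2 e₁ prime[3] 3∤z₁ ≤-refl y≡ (ratio≤ 7 6 e₂ prime[7] 7∤z₂ ≤-refl z₁≡ (ratio-2^ e z₂≡)))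
  ... | split p₃ e₃ z₃ pr₃ 2<p₃ z₂≡ p₃∤z₃ 1≤z₃ =
    weaken (ratio≤ 3 2 e₁ prime[3] 3∤z₁ ≤-refl y≡ (ratio≤ 7 6 e₂ prime[7] 7∤z₂ ≤-refl z₁≡
      (ratio≤ p₃ 14 e₃ pr₃ p₃∤z₃ 15≤p₃ z₂≡
        (ratio-cofactor z₃ e₁ e₂ e₃ prime[3] (s≤s (s≤s (s≤s z≤n))) prime[7] (s≤s (s≤s (s≤s z≤n))) pr₃ 2<p₃ 16∤ 1≤z₃))))
    where
    φ≡ = φ-split₃ z₁ z₂ z₃ 3 e₁ 7 e₂ p₃ e₃ (φ-split e₁ prime[3] 3∤z₁ y≡) (φ-split e₂ prime[7] 7∤z₂ z₁≡) (φ-split e₃ pr₃ p₃∤z₃ z₂≡)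
    16∤ = subst (16 ∤_) φ≡ 16∤φy
    p₃≢11 : p₃ ≢ 11
    p₃≢11 refl = 25∤φ-3,7,11 e₁ e₂ e₃
      (cofactor z₃ e₁ e₂ e₃ prime[3] (s≤s (s≤s (s≤s z≤n))) prime[7] (s≤s (s≤s (s≤s z≤n))) pr₃ 2<p₃ 16∤ 1≤z₃)
      (subst (25 ∣_) φ≡ 25∣φy)
    15≤p₃ : 15 ≤ p₃
    15≤p₃ = ≡3[4]∧≢3,7,11⇒15≤
      (third≡3[4] z₃ e₁ e₂ e₃ prime[3] (s≤s (s≤s (s≤s z≤n))) prime[7] (s≤s (s≤s (s≤s z≤n))) pr₃ 2<p₃ 16∤)
      (∤⇒≢factor e₃ z₃ (∤⇒∤cofactor 7 e₂ z₂ 3∤z₁ z₁≡) z₂≡)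
      (∤⇒≢factor e₃ z₃ 7∤z₂ z₂≡) p₃≢11
  ratio≤15/4 | yes 3∣y | e₁ , z₁ , y≡ , 3∤z₁ , 1≤z₁ | no 7∤z₁ with oddPrimePart z₁ 1≤z₁
  ... | pow₂ e z₁≡ = weaken (ratio≤ 3 2 e₁ prime[3] 3∤z₁ ≤-refl y≡ (ratio-2^ e z₁≡))
  ... | split p₂ e₂ z₂ pr₂ 2<p₂ z₁≡ p₂∤z₂ 1≤z₂ with oddPrimePart z₂ 1≤z₂
  -- The extremal case, containing ℛ: 2 · 3/2 · 5/4 = 15/4.
  ... | pow₂ e z₂≡ = weaken (ratio≤ 3 2 e₁ prime[3] 3∤z₁ ≤-refl y≡
        (ratio≤ p₂ 4 e₂ pr₂ p₂∤z₂ (oddPrime≢3⇒5≤ pr₂ 2<p₂ (∤⇒≢factor e₂ z₂ 3∤z₁ z₁≡)) z₁≡ (ratio-2^ e z₂≡)))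
  -- Here 2 · 3/2 · (11/10)² = 363/100 < 15/4.
  ... | split p₃ e₃ z₃ pr₃ 2<p₃ z₂≡ p₃∤z₃ 1≤z₃ =
    weaken (ratio≤ 3 2 e₁ prime[3] 3∤z₁ ≤-refl y≡ (ratio≤ p₂ 10 e₂ pr₂ p₂∤z₂ 11≤p₂ z₁≡
      (ratio≤ p₃ 10 e₃ pr₃ p₃∤z₃ 11≤p₃ z₂≡
        (ratio-cofactor z₃ e₁ e₂ e₃ prime[3] (s≤s (s≤s (s≤s z≤n))) pr₂ 2<p₂ pr₃ 2<p₃ 16∤ 1≤z₃))))
    where
    16∤ = subst (16 ∤_) (φ-split₃ z₁ z₂ z₃ 3 e₁ p₂ e₂ p₃ e₃ (φ-split e₁ prime[3] 3∤z₁ y≡)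
            (φ-split e₂ pr₂ p₂∤z₂ z₁≡) (φ-split e₃ pr₃ p₃∤z₃ z₂≡)) 16∤φy
    11≤p₂ : 11 ≤ p₂
    11≤p₂ = ≡3[4]∧≢3,7⇒11≤
      (second≡3[4] z₃ e₁ e₂ e₃ prime[3] (s≤s (s≤s (s≤s z≤n))) pr₂ 2<p₂ pr₃ 2<p₃ 16∤)
      (∤⇒≢factor e₂ z₂ 3∤z₁ z₁≡) (∤⇒≢factor e₂ z₂ 7∤z₁ z₁≡)
    11≤p₃ : 11 ≤ p₃
    11≤p₃ = ≡3[4]∧≢3,7⇒11≤
      (third≡3[4] z₃ e₁ e₂ e₃ prime[3] (s≤s (s≤s (s≤s z≤n))) pr₂ 2<p₂ pr₃ 2<p₃ 16∤)
      (∤⇒≢factor e₃ z₃ (∤⇒∤cofactor p₂ e₂ z₂ 3∤z₁ z₁≡) z₂≡)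
      (∤⇒≢factor e₃ z₃ (∤⇒∤cofactor p₂ e₂ z₂ 7∤z₁ z₁≡) z₂≡)
  ratio≤15/4 | no 3∤y with oddPrimePart y 1≤y
  ... | pow₂ e y≡ = weaken (ratio-2^ e y≡)
  ... | split p₁ e₁ z₁ pr₁ 2<p₁ y≡ p₁∤z₁ 1≤z₁ with oddPrimePart z₁ 1≤z₁
  ... | pow₂ e z₁≡ = weaken (ratio≤ p₁ 2 e₁ pr₁ p₁∤z₁ 2<p₁ y≡ (ratio-2^ e z₁≡))
  ... | split p₂ e₂ z₂ pr₂ 2<p₂ z₁≡ p₂∤z₂ 1≤z₂ with oddPrimePart z₂ 1≤z₂
  ... | pow₂ e z₂≡ = weaken (ratio≤ p₁ 4 e₁ pr₁ p₁∤z₁ (oddPrime≢3⇒5≤ pr₁ 2<p₁ (∤⇒≢factor e₁ z₁ 3∤y y≡)) y≡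
        (ratio≤ p₂ 4 e₂ pr₂ p₂∤z₂ (oddPrime≢3⇒5≤ pr₂ 2<p₂ (∤⇒≢factor e₂ z₂ (∤⇒∤cofactor p₁ e₁ z₁ 3∤y y≡) z₁≡)) z₁≡ (ratio-2^ e z₂≡)))
  -- Here 2 · (7/6)³ = 343/108 < 15/4.
  ... | split p₃ e₃ z₃ pr₃ 2<p₃ z₂≡ p₃∤z₃ 1≤z₃ =
    weaken (ratio≤ p₁ 6 e₁ pr₁ p₁∤z₁ (≡3[4]∧≢3⇒7≤ (first≡3[4] z₃ e₁ e₂ e₃ pr₁ 2<p₁ pr₂ 2<p₂ pr₃ 2<p₃ 16∤) (∤⇒≢factor e₁ z₁ 3∤y y≡)) y≡
      (ratio≤ p₂ 6 e₂ pr₂ p₂∤z₂ (≡3[4]∧≢3⇒7≤ (second≡3[4] z₃ e₁ e₂ e₃ pr₁ 2<p₁ pr₂ 2<p₂ pr₃ 2<p₃ 16∤) (∤⇒≢factor e₂ z₂ 3∤z₁ z₁≡)) z₁≡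
        (ratio≤ p₃ 6 e₃ pr₃ p₃∤z₃ (≡3[4]∧≢3⇒7≤ (third≡3[4] z₃ e₁ e₂ e₃ pr₁ 2<p₁ pr₂ 2<p₂ pr₃ 2<p₃ 16∤) (∤⇒≢factor e₃ z₃ 3∤z₂ z₂≡)) z₂≡
          (ratio-cofactor z₃ e₁ e₂ e₃ pr₁ 2<p₁ pr₂ 2<p₂ pr₃ 2<p₃ 16∤ 1≤z₃))))
    where
    3∤z₁ = ∤⇒∤cofactor p₁ e₁ z₁ 3∤y y≡
    3∤z₂ = ∤⇒∤cofactor p₂ e₂ z₂ 3∤z₁ z₁≡
    16∤ = subst (16 ∤_) (φ-split₃ z₁ z₂ z₃ p₁ e₁ p₂ e₂ p₃ e₃ (φ-split e₁ pr₁ p₁∤z₁ y≡)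
            (φ-split e₂ pr₂ p₂∤z₂ z₁≡) (φ-split e₃ pr₃ p₃∤z₃ z₂≡)) 16∤φy

φ-R : ∀ a b → φ (R (suc a) (suc b)) ≡ 8 * (3 ^ a * 5 ^ b)
φ-R a b = begin
  φ (2 * 3 ^ suc a * 5 ^ suc b)         ≡⟨ cong φ (*-assoc 2 (3 ^ suc a) (5 ^ suc b)) ⟩
  φ (2 * (3 ^ suc a * 5 ^ suc b))
    ≡⟨ φ-∤ prime[2] (∤-* prime[2] (∤-^ (suc a) prime[2] (toWitnessFalse {a? = 2 ∣? 3} _))
                                  (∤-^ (suc b) prime[2] (toWitnessFalse {a? = 2 ∣? 5} _))) ⟩
  1 * φ (3 ^ suc a * 5 ^ suc b)
    ≡⟨ cong (1 *_) (φ-^* a prime[3] (∤-^ (suc b) prime[3] (toWitnessFalse {a? = 3 ∣? 5} _))) ⟩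
  1 * (3 ^ a * 2 * φ (5 ^ suc b))       ≡⟨ cong (λ k → 1 * (3 ^ a * 2 * k)) (φ-^ b prime[5]) ⟩
  1 * (3 ^ a * 2 * (5 ^ b * 4))         ≡⟨ regroup (3 ^ a) (5 ^ b) ⟩
  8 * (3 ^ a * 5 ^ b)                   ∎
  where
  open ≡-Reasoning
  regroup : ∀ u v → 1 * (u * 2 * (v * 4)) ≡ 8 * (u * v)
  regroup = solve-∀

4R≡15φ : ∀ a b → 4 * R (suc a) (suc b) ≡ 15 * φ (R (suc a) (suc b))
4R≡15φ a b = trans (regroup (3 ^ a) (5 ^ b)) (cong (15 *_) (sym (φ-R a b)))
  where
  regroup : ∀ u v → 4 * (2 * (3 * u) * (5 * v)) ≡ 15 * (8 * (u * v))
  regroup = solve-∀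

1≤R : ∀ a b → 1 ≤ R a b
1≤R a b = *-mono-≤ {1} {2 * 3 ^ a} (*-mono-≤ {1} {2} (s≤s z≤n) (m^n>0 3 a)) (m^n>0 5 b)

-- The ratio of `x` is exactly 15/4, so `ratio≤15/4` for `y` in the same fibre gives 4y ≤ 15 φ(y) =
-- 15 φ(x) = 4x.
ℛ⊆N₂ : ℛ ⊆ N₂
ℛ⊆N₂ x (suc a , suc (suc (suc b)) , _ , s≤s (s≤s (s≤s _)) , refl) =
  φ x , (x , 1≤x , refl) , (1≤x , refl) , max
  where
  m = 8 * (3 ^ a * 5 ^ suc (suc b))

  1≤x : 1 ≤ x
  1≤x = 1≤R (suc a) (suc (suc (suc b)))

  16∤m : 16 ∤ m
  16∤m 16∣m = ∤-* prime[2] (∤-^ a prime[2] (toWitnessFalse {a? = 2 ∣? 3} _))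
    (∤-^ (suc (suc b)) prime[2] (toWitnessFalse {a? = 2 ∣? 5} _))
    (*-cancelˡ-∣ {m = 2} {n = 3 ^ a * 5 ^ suc (suc b)} 8 16∣m)

  -- With r₂ = b + 3, the power of 5 in `m` is 5^(b+2); this is where `2 < r₂` enters.
  25∣m : 25 ∣ m
  25∣m = ∣n⇒∣m*n 8 (∣n⇒∣m*n (3 ^ a) (subst (25 ∣_) (*-assoc 5 5 (5 ^ b)) (m∣m*n (5 ^ b))))

  max : ∀ y → InPhiInv (φ x) y → y ≤ x
  max y (1≤y , φy≡φx) = *-cancelˡ-≤ 4 (begin
    4 * y        ≤⟨ d*y≤c*φy (ratio≤15/4 1≤y (subst (16 ∤_) (sym φy≡m) 16∤m) (subst (25 ∣_) (sym φy≡m) 25∣m)) ⟩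
    15 * φ y     ≡⟨ cong (15 *_) φy≡φx ⟩
    15 * φ x     ≡⟨ 4R≡15φ a (suc (suc b)) ⟨
    4 * x        ∎)
    where
    open ≤-Reasoning
    φy≡m : φ y ≡ m
    φy≡m = trans φy≡φx (φ-R a (suc (suc b)))

ℛ-infinite : Infinite ℛ
ℛ-infinite n = R 1 (n + 3) , (1 , n + 3 , s≤s z≤n , m≤n+m 3 n , refl) ,
  ≤-trans (m≤m+n n 3) (≤-trans (n≤b^n (n + 3) (s≤s (s≤s z≤n))) (m≤n*m (5 ^ (n + 3)) 6))

ℛ∩N₁-finite : FinitelyManyOf ℛ N₁
ℛ∩N₁-finite = 2310 , λ { x (suc a , suc b , _ , _ , refl) → N₁⇒<2310
  (*-cancelˡ-≤ 4 (≤-trans (≤-reflexive (4R≡15φ a b)) (≤-trans (*-monoˡ-≤ (φ (R (suc a) (suc b))) (m≤m+n 15 1))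
    (≤-reflexive (*-assoc 4 4 (φ (R (suc a) (suc b)))))))) }

-- The family ℱ

-- Modulo x + 1 this is (-1)^odd = -1. The induction avoids subtraction: with u = x^(2h+1), x u (x +
-- 1) + (u + 1) equals u (x + 1) + (x² u + 1).
x+1∣x^odd+1 : ∀ x h → x + 1 ∣ x ^ suc (2 * h) + 1
x+1∣x^odd+1 x zero    = ∣-reflexive (cong (_+ 1) (sym (*-identityʳ x)))
x+1∣x^odd+1 x (suc h) = subst (λ k → x + 1 ∣ x ^ suc k + 1) (sym (*-suc 2 h))
  (∣m+n∣m⇒∣n (subst (x + 1 ∣_) (regroup x (x ^ suc (2 * h)))
               (∣m∣n⇒∣m+n (n∣m*n (x * x ^ suc (2 * h))) (x+1∣x^odd+1 x h)))
             (n∣m*n (x ^ suc (2 * h))))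
  where
  regroup : ∀ x u → x * u * (x + 1) + (u + 1) ≡ u * (x + 1) + (x * (x * u) + 1)
  regroup = solve-∀

-- An odd prime p dividing t = c p would make 2^c + 1 a proper divisor of 2^t + 1.
2^t+1-prime⇒fermat : ∀ t → 1 ≤ t → Prime (2 ^ t + 1) → ∃[ l ] t ≡ 2 ^ l
2^t+1-prime⇒fermat t 1≤t pr with pow₂⊎odd∣ t 1≤t
... | inj₁ t≡2^l = t≡2^l
... | inj₂ (p , pp , 2<p , divides c refl) with even⊎odd p
...   | inj₁ (h , refl) = contradiction (prime∣prime⇒≡ prime[2] pp (m∣m*n h)) (<⇒≢ 2<p)
...   | inj₂ (h , refl) with prime⇒irreducible pr
          (subst (λ k → 2 ^ c + 1 ∣ k + 1) (^-*-assoc 2 c (suc (2 * h))) (x+1∣x^odd+1 (2 ^ c) h))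
...     | inj₁ 2^c+1≡1 = contradiction (sym 2^c+1≡1) (<⇒≢ (+-monoˡ-≤ 1 (m^n>0 2 c)))
...     | inj₂ 2^c+1≡2^t+1 = contradiction (+-cancelʳ-≡ 1 _ _ 2^c+1≡2^t+1) (<⇒≢ (^-monoʳ-< 2 ≤-refl
            (m<m*n c (suc (2 * h)) {{c≢0 c 1≤t}} (prime>1 pp))))
  where
  c≢0 : ∀ {p} c → 1 ≤ c * p → NonZero c
  c≢0 (suc c) _ = _

∣2^⇒≡2^ : ∀ {d} s → d ∣ 2 ^ s → ∃[ t ] d ≡ 2 ^ t
∣2^⇒≡2^ {zero} s 0∣ = contradiction (0∣⇒≡0 0∣) (≢-nonZero⁻¹ (2 ^ s) {{m^n≢0 2 s}})
∣2^⇒≡2^ {d@(suc _)} s d∣ with pow₂⊎odd∣ d (s≤s z≤n)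
... | inj₁ d≡2^t = d≡2^t
... | inj₂ (p , pr , 2<p , p∣d) = contradiction
        (prime∣prime⇒≡ pr prime[2] (prime∣^⇒∣ s pr (∣-trans p∣d d∣))) (<⇒≢ 2<p ∘ sym)

∤2^ : ∀ {p} s → Prime p → 2 < p → p ∤ 2 ^ s
∤2^ s pr 2<p p∣ = <⇒≢ 2<p (sym (prime∣prime⇒≡ pr prime[2] (prime∣^⇒∣ s pr p∣)))

prime∸1+1 : ∀ {p} → Prime p → p ∸ 1 + 1 ≡ p
prime∸1+1 pr = m∸n+n≡m (<⇒≤ (prime>1 pr))

-- The factor p - 1 of φ(y) is a power of 2, so p = 2^t + 1, and primality makes t a power of 2.
φ≡2^⇒fermat : ∀ {y p} s → 1 ≤ y → φ y ≡ 2 ^ s → Prime p → 2 < p → p ∣ y → FermatPrime p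
φ≡2^⇒fermat {y} {p} s 1≤y φy≡2^s pr 2<p p∣y with factorOut pr y 1≤y p∣y
... | e , z , refl , p∤z , 1≤z with ∣2^⇒≡2^ {p ∸ 1} s (subst (p ∸ 1 ∣_) (trans (sym (φ-^* e pr p∤z)) φy≡2^s)
                                      (∣m⇒∣m*n (φ z) (n∣m*n (p ^ e))))
...   | zero , p∸1≡1 = contradiction (trans (sym (prime∸1+1 pr)) (cong (_+ 1) p∸1≡1)) (<⇒≢ 2<p ∘ sym)
...   | suc t , p∸1≡2^t with 2^t+1-prime⇒fermat (suc t) (s≤s z≤n) (subst Prime (trans (sym (prime∸1+1 pr)) (cong (_+ 1) p∸1≡2^t)) pr)
...     | l , t≡2^l = pr , l , trans (sym (prime∸1+1 pr)) (cong (_+ 1) (trans p∸1≡2^t (cong (2 ^_) t≡2^l)))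

-- Ratio bound for numbers whose odd primes are Fermat primes

2<fermat : ∀ {p} → FermatPrime p → 2 < p
2<fermat (_ , l , refl) = +-monoˡ-≤ 1 (^-monoʳ-≤ 2 (m^n>0 2 l))

-- A Fermat number less one. Squaring leads from `N l` to `N (suc l)`, which makes the products
-- below telescope.
N : ℕ → ℕ
N l = 2 ^ (2 ^ l)

N-suc : ∀ l → N (suc l) ≡ N l * N l
N-suc l = trans (cong (2 ^_) (cong (2 ^ l +_) (+-identityʳ (2 ^ l)))) (^-distribˡ-+-* 2 (2 ^ l) (2 ^ l))

1≤N : ∀ l → 1 ≤ N l
1≤N l = m^n>0 2 (2 ^ l)

2≤N : ∀ l → 2 ≤ N l
2≤N l = ^-monoʳ-≤ 2 (m^n>0 2 l)

N-mono : ∀ {k l} → k ≤ l → N k ≤ N l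
N-mono k≤l = ^-monoʳ-≤ 2 (^-monoʳ-≤ 2 k≤l)

l<N+1 : ∀ l → l < N l + 1
l<N+1 l = ≤-trans (n<2^n l) (≤-trans (<⇒≤ (n<2^n (2 ^ l))) (m≤m+n (N l) 1))

-- The product of (1 + 1/N l) over l ≥ L telescopes to 1/(1 − 1/N L); the claim is
-- z/φ(z) ≤ 2/(1 − 1/N L) with the denominator cleared and the subtraction moved over.
fermat-ratio-below : ∀ d L {z} → 1 ≤ z →
  (∀ {p} → Prime p → 2 < p → p ∣ z → ∃[ l ] (L ≤ l × l < d + L × p ≡ N l + 1)) →
  N L * z ≤ 2 * N L * φ z + z
fermat-ratio-below zero L {z} 1≤z H with pow₂⊎odd∣ z 1≤z
... | inj₁ (e , refl) = begin
        N L * z              ≡⟨ cong (N L *_) (*-identityˡ z) ⟨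
        N L * (1 * z)        ≤⟨ *-monoʳ-≤ (N L) (Ratio≤.d*y≤c*φy (ratio-pow₂ e)) ⟩
        N L * (2 * φ z)      ≡⟨ *-assoc (N L) 2 (φ z) ⟨
        N L * 2 * φ z        ≡⟨ cong (_* φ z) (*-comm (N L) 2) ⟩
        2 * N L * φ z        ≤⟨ m≤m+n _ z ⟩
        2 * N L * φ z + z    ∎
  where open ≤-Reasoning
... | inj₂ (p , pr , 2<p , p∣z) with H pr 2<p p∣z
...   | l , L≤l , l<L , _ = contradiction L≤l (<⇒≱ l<L)
fermat-ratio-below (suc d) L {z} 1≤z H with prime? (N L + 1) ×-dec (N L + 1 ∣? z)
-- If `N L + 1` is not a prime factor, the sharper bound for `suc L` is weakened.
... | no ¬F∣z = *-cancelˡ-≤ (N L) {{>-nonZero (1≤N L)}} (begin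
        N L * (N L * z)                   ≡⟨ *-assoc (N L) (N L) z ⟨
        N L * N L * z                     ≡⟨ cong (_* z) (N-suc L) ⟨
        N (suc L) * z                     ≤⟨ fermat-ratio-below d (suc L) 1≤z H′ ⟩
        2 * N (suc L) * φ z + z           ≤⟨ +-monoʳ-≤ _ (m≤n*m z (N L) {{>-nonZero (1≤N L)}}) ⟩
        2 * N (suc L) * φ z + N L * z     ≡⟨ cong (λ k → 2 * k * φ z + N L * z) (N-suc L) ⟩
        2 * (N L * N L) * φ z + N L * z   ≡⟨ regroup (N L) (φ z) z ⟩
        N L * (2 * N L * φ z + z)         ∎)
  where
  open ≤-Reasoning
  regroup : ∀ n f z → 2 * (n * n) * f + n * z ≡ n * (2 * n * f + z)
  regroup = solve-∀
  H′ : ∀ {p} → Prime p → 2 < p → p ∣ z → ∃[ l ] (suc L ≤ l × l < d + suc L × p ≡ N l + 1)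
  H′ pr 2<p p∣z with H pr 2<p p∣z
  ... | l , L≤l , l<d+L , refl = l , ≤∧≢⇒< L≤l (λ { refl → ¬F∣z (pr , p∣z) }) ,
        subst (l <_) (sym (+-suc d L)) l<d+L , refl
... | yes (F-prime , F∣z) with factorOut F-prime z 1≤z F∣z
...   | e , z′ , refl , F∤z′ , 1≤z′ = begin
        -- As n F = n² + n and n² is `N (suc L)`, the claim is the one for `z′` at `suc L` with n z′
        -- added on both sides.
        n * (F * F ^ e * z′)                                  ≡⟨ regroup₁ n (F ^ e) z′ ⟩
        F ^ e * (n * n * z′ + n * z′)                         ≡⟨ cong (λ k → F ^ e * (k * z′ + n * z′)) (N-suc L) ⟨
        F ^ e * (N (suc L) * z′ + n * z′)
          ≤⟨ *-monoʳ-≤ (F ^ e) (+-monoˡ-≤ (n * z′) (fermat-ratio-below d (suc L) 1≤z′ H′)) ⟩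
        F ^ e * (2 * N (suc L) * φ z′ + z′ + n * z′)
          ≡⟨ cong (λ k → F ^ e * (2 * k * φ z′ + z′ + n * z′)) (N-suc L) ⟩
        F ^ e * (2 * (n * n) * φ z′ + z′ + n * z′)            ≡⟨ regroup₂ n (F ^ e) z′ (φ z′) ⟩
        2 * n * (F ^ e * n * φ z′) + F * F ^ e * z′
          ≡⟨ cong (λ k → 2 * n * (F ^ e * k * φ z′) + F * F ^ e * z′) (m+n∸n≡m n 1) ⟨
        2 * n * (F ^ e * (F ∸ 1) * φ z′) + F * F ^ e * z′
          ≡⟨ cong (λ k → 2 * n * k + F * F ^ e * z′) (φ-^* e F-prime F∤z′) ⟨
        2 * n * φ (F ^ suc e * z′) + F * F ^ e * z′           ∎
  where
  open ≤-Reasoning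
  n = N L
  F = n + 1
  regroup₁ : ∀ n P z → n * ((n + 1) * P * z) ≡ P * (n * n * z + n * z)
  regroup₁ = solve-∀
  regroup₂ : ∀ n P z f → P * (2 * (n * n) * f + z + n * z) ≡ 2 * n * (P * n * f) + (n + 1) * P * z
  regroup₂ = solve-∀
  H′ : ∀ {p} → Prime p → 2 < p → p ∣ z′ → ∃[ l ] (suc L ≤ l × l < d + suc L × p ≡ N l + 1)
  H′ pr 2<p p∣z′ with H pr 2<p (∣n⇒∣m*n (F ^ suc e) p∣z′)
  ... | l , L≤l , l<d+L , refl = l , ≤∧≢⇒< L≤l (λ { refl → F∤z′ p∣z′ }) ,
        subst (l <_) (sym (+-suc d L)) l<d+L , refl

fermat-ratio : ∀ L {z} → 1 ≤ z →
  (∀ {p} → Prime p → 2 < p → p ∣ z → ∃[ l ] (L ≤ l × p ≡ N l + 1)) →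
  N L * z ≤ 2 * N L * φ z + z
-- The range `d = z` suffices because l < N l + 1 ≤ z whenever N l + 1 divides z.
fermat-ratio L {z} 1≤z H = fermat-ratio-below z L 1≤z λ pr 2<p p∣z → bounded p∣z (H pr 2<p p∣z)
  where
  bounded : ∀ {p} → p ∣ z → ∃[ l ] (L ≤ l × p ≡ N l + 1) → ∃[ l ] (L ≤ l × l < z + L × p ≡ N l + 1)
  bounded p∣z (l , L≤l , refl) = l , L≤l ,
    ≤-trans (l<N+1 l) (≤-trans (∣⇒≤ {{>-nonZero 1≤z}} p∣z) (m≤m+n z L)) , refl

-- Comparison of y with 2^a times a product of Fermat primes

∤-product : ∀ {F a ps} → Prime F → 2 < F → All (F <_) ps → All Prime ps → F ∤ 2 ^ a * product ps
∤-product {F} {a} {ps} pr 2<F F<ps prs F∣ = [ ∤2^ a pr 2<F , F∤Πps ]′ (euclidsLemma (2 ^ a) (product ps) pr F∣)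
  where
  F∤Πps : F ∤ product ps
  F∤Πps F∣Πps = <-irrefl refl (All.lookup F<ps (factorisationHasAllPrimeFactors pr F∣Πps prs))

2^a*[F*Π]≡ : ∀ a F P → 2 ^ a * (F * P) ≡ F * (2 ^ a * P)
2^a*[F*Π]≡ a F P = swap (2 ^ a) F P
  where
  swap : ∀ u v w → u * (v * w) ≡ v * (u * w)
  swap = solve-∀

φ-2^*product-∷ : ∀ a {F ps} → AllPairs _<_ (F ∷ ps) → All FermatPrime (F ∷ ps) →
  φ (2 ^ a * product (F ∷ ps)) ≡ (F ∸ 1) * φ (2 ^ a * product ps)
φ-2^*product-∷ a {F} {ps} (F<ps ∷ _) (fF ∷ fps) = trans (cong φ (2^a*[F*Π]≡ a F (product ps)))
  (φ-∤ (proj₁ fF) (∤-product {a = a} (proj₁ fF) (2<fermat fF) F<ps (All.map proj₁ fps)))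

φ-2^*product≡2^ : ∀ a {ps} → AllPairs _<_ ps → All FermatPrime ps → ∃[ s ] φ (2 ^ suc a * product ps) ≡ 2 ^ s
φ-2^*product≡2^ a [] [] = a , trans (cong φ (*-identityʳ (2 ^ suc a))) (φ-2^ a)
φ-2^*product≡2^ a {F ∷ ps} sorted@(_ ∷ sorted′) fs@((_ , l , refl) ∷ fps) with φ-2^*product≡2^ a sorted′ fps
... | s , eq = 2 ^ l + s , trans (φ-2^*product-∷ (suc a) sorted fs)
        (trans (cong₂ _*_ (m+n∸n≡m (N l) 1) eq) (sym (^-distribˡ-+-* 2 (2 ^ l) s)))

2φ≤ : ∀ a {ps} → All Prime ps → 2 * φ (2 ^ suc a * product ps) ≤ 2 ^ suc a * product ps
2φ≤ a {ps} prs = begin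
  2 * φ (2 ^ suc a * product ps)      ≡⟨ cong (λ k → 2 * φ k) (*-comm (2 ^ suc a) (product ps)) ⟩
  2 * φ (product ps * 2 ^ suc a)      ≤⟨ *-monoʳ-≤ 2 (φ-product*≤ (2 ^ suc a) prs) ⟩
  2 * (product ps * φ (2 ^ suc a))    ≡⟨ cong (λ k → 2 * (product ps * k)) (φ-2^ a) ⟩
  2 * (product ps * 2 ^ a)            ≡⟨ regroup (product ps) (2 ^ a) ⟩
  2 ^ suc a * product ps              ∎
  where
  open ≤-Reasoning
  regroup : ∀ u v → 2 * (u * v) ≡ 2 * v * u
  regroup = solve-∀

-- (1 − 1/n²)⁻¹ ≤ 1 + 1/n for n ≥ 2.
cancel-ratio : ∀ n {x′ y f} → 2 ≤ n → n * n * y ≤ 2 * (n * n) * (n * f) + y → 2 * f ≤ x′ → y ≤ (n + 1) * x′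
cancel-ratio 1 (s≤s ())
-- With k = n + 2, the polynomials 3 + 4n + n² and 1 + 3n + n² are k² - 1 and k² - k - 1, and (k² -
-- 1)(k + 1) = k³ + (k² - k - 1).
cancel-ratio (suc (suc n)) {x′} {y} {f} _ bound 2f≤x′ = *-cancelˡ-≤ (3 + 4 * n + n * n) (+-cancelʳ-≤ y _ _ (begin
  (3 + 4 * n + n * n) * y + y                                    ≡⟨ square n y ⟩
  k * k * y                                                      ≤⟨ bound ⟩
  2 * (k * k) * (k * f) + y                                      ≡⟨ cong (_+ y) (regroup k f) ⟩
  k * k * k * (2 * f) + y                                        ≤⟨ +-monoˡ-≤ y (*-monoʳ-≤ (k * k * k) 2f≤x′) ⟩
  k * k * k * x′ + y                                             ≤⟨ +-monoˡ-≤ y (m≤m+n _ ((1 + 3 * n + n * n) * x′)) ⟩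
  k * k * k * x′ + (1 + 3 * n + n * n) * x′ + y                  ≡⟨ cong (_+ y) (cube n x′) ⟩
  (3 + 4 * n + n * n) * ((k + 1) * x′) + y                       ∎))
  where
  open ≤-Reasoning
  k = 2 + n
  square : ∀ n y → (3 + 4 * n + n * n) * y + y ≡ (2 + n) * (2 + n) * y
  square = solve-∀
  regroup : ∀ k f → 2 * (k * k) * (k * f) ≡ k * k * k * (2 * f)
  regroup = solve-∀
  cube : ∀ n x → (2 + n) * (2 + n) * (2 + n) * x + (1 + 3 * n + n * n) * x ≡ (3 + 4 * n + n * n) * ((2 + n + 1) * x)
  cube = solve-∀

-- Stated for any list, so that it survives cancelling the head. The clause `2 ^ a < p` carries the
-- bound on a.
FermatSplit : ℕ → List ℕ → ℕ → Set
FermatSplit a ps y = ∀ {p} → Prime p → 2 < p → p ∣ y → FermatPrime p × (p ∈ ps ⊎ (All (_< p) ps × 2 ^ a < p))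

φ≡⇒≤ : ∀ a s {ps y} → 1 ≤ y → AllPairs _<_ ps → All FermatPrime ps → FermatSplit (suc a) ps y →
  φ y ≡ 2 ^ s → φ y ≡ φ (2 ^ suc a * product ps) → y ≤ 2 ^ suc a * product ps
φ≡⇒≤ a s {[]} {y} 1≤y [] [] H _ φy≡ with pow₂⊎odd∣ y 1≤y | trans φy≡ (trans (cong φ (*-identityʳ (2 ^ suc a))) (φ-2^ a))
... | inj₁ (zero , refl)  | _ = subst (1 ≤_) (sym (*-identityʳ (2 ^ suc a))) (m^n>0 2 (suc a))
... | inj₁ (suc e , refl) | φy≡2^a = ≤-reflexive (trans (cong (2 *_) (trans (sym (φ-2^ e)) φy≡2^a)) (sym (*-identityʳ (2 ^ suc a))))
... | inj₂ (p , pr , 2<p , p∣y) | φy≡2^a with H pr 2<p p∣y | factorOut pr y 1≤y p∣y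
-- A remaining odd prime p exceeds 2^(a+1), yet p - 1 divides φ(y) = 2^a.
...   | _ , inj₂ (_ , 2^a<p) | e , z , refl , p∤z , _ = contradiction 2^a<p (≤⇒≯ (begin
          p               ≡⟨ prime∸1+1 pr ⟨
          p ∸ 1 + 1       ≤⟨ +-mono-≤ p∸1≤2^a (m^n>0 2 a) ⟩
          2 ^ a + 2 ^ a   ≡⟨ cong (2 ^ a +_) (+-identityʳ (2 ^ a)) ⟨
          2 ^ suc a       ∎))
  where
  open ≤-Reasoning
  p∸1≤2^a : p ∸ 1 ≤ 2 ^ a
  p∸1≤2^a = ∣⇒≤ {{m^n≢0 2 a}} (subst (p ∸ 1 ∣_) (trans (sym (φ-^* e pr p∤z)) φy≡2^a) (∣m⇒∣m*n (φ z) (n∣m*n (p ^ e))))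
φ≡⇒≤ a s {F ∷ ps} {y} 1≤y sorted@(F<ps ∷ sorted′) fs@(fF@(F-prime , l , refl) ∷ fps) H φy≡2^s φy≡ with F ∣? y
-- All odd primes of `y` are now Fermat primes above `F`, so `fermat-ratio` applies from `suc l` on.
... | no F∤y = subst (y ≤_) (sym (2^a*[F*Π]≡ (suc a) F (product ps)))
        (cancel-ratio (N l) (2≤N l) bound (2φ≤ a (All.map proj₁ fps)))
  where
  x′ = 2 ^ suc a * product ps

  above : ∀ {p} → Prime p → 2 < p → p ∣ y → ∃[ k ] (suc l ≤ k × p ≡ N k + 1)
  above pr 2<p p∣y with H pr 2<p p∣y
  ... | _              , inj₁ (here refl)     = contradiction p∣y F∤y
  ... | (_ , k , refl) , inj₁ (there p∈ps)    = k , ≰⇒> (λ k≤l → <⇒≱ (All.lookup F<ps p∈ps) (+-monoˡ-≤ 1 (N-mono k≤l))) , refl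
  ... | (_ , k , refl) , inj₂ ((F<p ∷ _) , _) = k , ≰⇒> (λ k≤l → <⇒≱ F<p (+-monoˡ-≤ 1 (N-mono k≤l))) , refl

  φy≡Nφx′ : φ y ≡ N l * φ x′
  φy≡Nφx′ = trans φy≡ (trans (φ-2^*product-∷ (suc a) sorted fs) (cong (_* φ x′) (m+n∸n≡m (N l) 1)))

  bound : N l * N l * y ≤ 2 * (N l * N l) * (N l * φ x′) + y
  bound = subst₂ (λ n f → n * y ≤ 2 * n * f + y) (N-suc l) φy≡Nφx′ (fermat-ratio (suc l) 1≤y above)
... | yes F∣y with factorOut F-prime y 1≤y F∣y
-- If F² divided `y`, then `F` would divide `φ y`, a power of 2.
...   | suc e , z , refl , F∤z , 1≤z = contradiction
          (subst (F ∣_) (trans (sym (φ-^* (suc e) F-prime F∤z)) φy≡2^s) (∣m⇒∣m*n (φ z) (∣m⇒∣m*n (F ∸ 1) (m∣m*n (F ^ e)))))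
          (∤2^ s F-prime (2<fermat fF))
...   | zero , z , refl , F∤z , 1≤z with ∣2^⇒≡2^ {φ z} s (subst (φ z ∣_) (trans (sym (φ-^* 0 F-prime F∤z)) φy≡2^s) (n∣m*n (F ^ 0 * (F ∸ 1))))
...     | s′ , φz≡2^s′ = begin
            F * 1 * z                    ≡⟨ cong (_* z) (*-identityʳ F) ⟩
            F * z                        ≤⟨ *-monoʳ-≤ F (φ≡⇒≤ a s′ 1≤z sorted′ fps H′ φz≡2^s′ φz≡) ⟩
            F * (2 ^ suc a * product ps) ≡⟨ 2^a*[F*Π]≡ (suc a) F (product ps) ⟨
            2 ^ suc a * (F * product ps) ∎
  where
  open ≤-Reasoning
  φz≡ : φ z ≡ φ (2 ^ suc a * product ps)
  φz≡ = *-cancelˡ-≡ _ _ (F ∸ 1) {{>-nonZero (m<n⇒0<n∸m (prime>1 F-prime))}}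
    (trans (cong (_* φ z) (sym (*-identityˡ (F ∸ 1)))) (trans (sym (φ-^* 0 F-prime F∤z)) (trans φy≡ (φ-2^*product-∷ (suc a) sorted fs))))

  H′ : FermatSplit (suc a) ps z
  H′ pr 2<p p∣z with H pr 2<p (∣n⇒∣m*n (F ^ 1) p∣z)
  ... | _  , inj₁ (here refl)           = contradiction p∣z F∤z
  ... | fp , inj₁ (there p∈ps)          = fp , inj₁ p∈ps
  ... | fp , inj₂ ((_ ∷ ps<p) , 2^a<p)  = fp , inj₂ (ps<p , 2^a<p)

-- Indexing of the Fermat primes

unique∧⊆⇒length≤ : ∀ {A : Set} {xs ys : List A} → Unique xs → (∀ {x} → x ∈ xs → x ∈ ys) → length xs ≤ length ys
unique∧⊆⇒length≤ [] _ = z≤n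
unique∧⊆⇒length≤ {xs = x ∷ xs} (x∉xs ∷ unique) ⊆ with ∈-∃++ (⊆ (here refl))
... | as , bs , refl = subst (suc (length xs) ≤_) (sym (length-middle as)) (s≤s (unique∧⊆⇒length≤ unique ⊆′))
  where
  length-middle : ∀ as → length (as ++ x ∷ bs) ≡ suc (length (as ++ bs))
  length-middle []       = refl
  length-middle (_ ∷ as) = cong suc (length-middle as)
  ⊆′ : ∀ {z} → z ∈ xs → z ∈ as ++ bs
  ⊆′ z∈xs with ∈-++⁻ as (⊆ (there z∈xs))
  ... | inj₁ z∈as          = ∈-++⁺ˡ z∈as
  ... | inj₂ (here refl)   = contradiction refl (All.lookup x∉xs z∈xs)
  ... | inj₂ (there z∈bs)  = ∈-++⁺ʳ as z∈bs

-- The Fermat primes below p, together with p itself, all lie below q.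
IsF-reflects-< : ∀ {i j p q} → IsF i p → IsF j q → p < q → i < j
IsF-reflects-< {p = p} {q} (fp , _ , xs , refl , unique , xs<p , _) (_ , _ , ys , refl , _ , _ , complete) p<q =
  +-monoˡ-< 1 (unique∧⊆⇒length≤ (All.map (λ (_ , x<p) → <⇒≢ x<p ∘ sym) xs<p ∷ unique) p∷xs⊆ys)
  where
  p∷xs⊆ys : ∀ {x} → x ∈ p ∷ xs → x ∈ ys
  p∷xs⊆ys (here refl)   = complete p fp p<q
  p∷xs⊆ys (there x∈xs) with All.lookup xs<p x∈xs
  ... | fx , x<p = complete _ fx (<-trans x<p p<q)

IsF-unique : ∀ {j p q} → IsF j p → IsF j q → p ≡ q
IsF-unique {p = p} {q} Fp Fq = ≤-antisym
  (≮⇒≥ λ q<p → <-irrefl refl (IsF-reflects-< Fq Fp q<p))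
  (≮⇒≥ λ p<q → <-irrefl refl (IsF-reflects-< Fp Fq p<q))

IsF-mono-< : ∀ {i j p q} → IsF i p → IsF j q → i < j → p < q
IsF-mono-< {p = p} {q} Fp Fq i<j = ≰⇒> λ q≤p → [ (λ q<p → <-asym i<j (IsF-reflects-< Fq Fp q<p)) ,
  (λ { refl → <-irrefl (index-unique Fp Fq) i<j }) ]′ (m≤n⇒m<n∨m≡n q≤p)
  where
  index-unique : ∀ {i j p} → IsF i p → IsF j p → i ≡ j
  index-unique (_ , _ , xs , refl , uxs , xs<p , cxs) (_ , _ , ys , refl , uys , ys<p , cys) = cong (_+ 1) (≤-antisym
    (unique∧⊆⇒length≤ uxs λ x∈ → let fx , x<p = All.lookup xs<p x∈ in cys _ fx x<p)
    (unique∧⊆⇒length≤ uys λ y∈ → let fy , y<p = All.lookup ys<p y∈ in cxs _ fy y<p))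

-- The search for the exponent is finite because l < N l + 1.
fermat? : ∀ p → Dec (FermatPrime p)
fermat? p = prime? p ×-dec map′ (λ (l , _ , eq) → l , eq) (λ { (l , refl) → l , l<N+1 l , refl })
                             (anyUpTo? (λ l → p ≟ N l + 1) p)

fermats : ℕ → List ℕ
fermats b = filter fermat? (upTo b)

∈-fermats : ∀ {b p} → FermatPrime p → p < b → p ∈ fermats b
∈-fermats fp p<b = ∈-filter⁺ fermat? (∈-upTo⁺ p<b) fp

fermat⇒IsF : ∀ {p} → FermatPrime p → IsF (length (fermats p) + 1) p
fermat⇒IsF {p} fp = fp , m≤n+m 1 (length (fermats p)) , fermats p , refl ,
  Unique.filter⁺ fermat? (Unique.upTo⁺ p) ,
  All.tabulate (λ y∈ → let y∈upTo , fy = ∈-filter⁻ fermat? y∈ in fy , ∈-upTo⁻ y∈upTo) ,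
  λ y fy y<p → ∈-fermats fy y<p

FermatsFrom-∷ʳ : ∀ {i} n {ys y} → FermatsFrom i n ys → IsF (n + i) y → FermatsFrom i (suc n) (ys ∷ʳ y)
FermatsFrom-∷ʳ zero refl Fy = Fy , refl
FermatsFrom-∷ʳ {i} (suc n) {_ ∷ _} {y} (Fz , Fzs) Fy =
  Fz , FermatsFrom-∷ʳ n Fzs (subst (λ k → IsF k y) (sym (+-suc n i)) Fy)

fermats-suc : ∀ b → fermats (suc b) ≡ fermats b ++ filter fermat? (b ∷ [])
fermats-suc b = trans (cong (filter fermat?) (sym (upTo-∷ʳ b))) (filter-++ fermat? (upTo b) (b ∷ []))

fermats-first : ∀ b → FirstFermats (length (fermats b)) (fermats b)
fermats-first zero    = refl
fermats-first (suc b) with fermat? b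
... | no ¬fb = subst (λ ys → FirstFermats (length ys) ys)
        (sym (trans (fermats-suc b) (trans (cong (fermats b ++_) (filter-reject fermat? ¬fb)) (++-identityʳ (fermats b)))))
        (fermats-first b)
... | yes fb = subst (λ ys → FirstFermats (length ys) ys)
        (sym (trans (fermats-suc b) (cong (fermats b ++_) (filter-accept fermat? fb))))
        (subst (λ n → FirstFermats n (fermats b ∷ʳ b)) (sym (trans (length-++ (fermats b)) (+-comm (length (fermats b)) 1)))
          (FermatsFrom-∷ʳ (length (fermats b)) (fermats-first b) (fermat⇒IsF fb)))

FermatsFrom-lookup : ∀ {i} n {ys} → FermatsFrom i n ys → ∀ {j} → i ≤ j → j < n + i → ∃[ p ] (p ∈ ys × IsF j p)
FermatsFrom-lookup zero refl i≤j j<i = contradiction i≤j (<⇒≱ j<i)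
FermatsFrom-lookup {i} (suc n) {y ∷ ys} (Fy , Fys) {j} i≤j j<n+i with i ≟ j
... | yes refl = y , here refl , Fy
... | no  i≢j with FermatsFrom-lookup n Fys (≤∧≢⇒< i≤j i≢j) (subst (j <_) (sym (+-suc n i)) j<n+i)
...   | p , p∈ys , Fp = p , there p∈ys , Fp

FermatsFrom⇒IsF : ∀ {i} n {ys} → FermatsFrom i n ys → All (λ y → ∃[ j ] (i ≤ j × j < n + i × IsF j y)) ys
FermatsFrom⇒IsF zero refl = []
FermatsFrom⇒IsF {i} (suc n) {y ∷ ys} (Fy , Fys) = (i , ≤-refl , s≤s (m≤n+m i n) , Fy) ∷
  All.map (λ (j , i<j , j< , Fj) → j , <⇒≤ i<j , subst (j <_) (+-suc n i) j< , Fj) (FermatsFrom⇒IsF n Fys)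

FermatsFrom-sorted : ∀ {i} n {ys} → FermatsFrom i n ys → AllPairs _<_ ys
FermatsFrom-sorted zero refl = []
FermatsFrom-sorted (suc n) {y ∷ ys} (Fy , Fys) =
  All.map (λ (j , i<j , _ , Fj) → IsF-mono-< Fy Fj i<j) (FermatsFrom⇒IsF n Fys) ∷ FermatsFrom-sorted n Fys

FermatsFrom-fermat : ∀ {i} n {ys} → FermatsFrom i n ys → All FermatPrime ys
FermatsFrom-fermat n Fys = All.map (λ (_ , _ , _ , fy , _) → fy) (FermatsFrom⇒IsF n Fys)

-- For i < j, F_i is found in the list of Fermat primes below p, which has at least j - 1 entries.
IsF-below : ∀ {j p} → IsF j p → ∀ {i} → 1 ≤ i → i ≤ j → ∃[ q ] IsF i q
IsF-below {j} {p} Fp {i} 1≤i i≤j with m≤n⇒m<n∨m≡n i≤j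
... | inj₂ refl = p , Fp
IsF-below {j} {p} Fp@(_ , _ , xs , refl , unique , xs<p , _) {i} 1≤i i≤j | inj₁ i<j
  with FermatsFrom-lookup (length (fermats p)) (fermats-first p) 1≤i
         (≤-trans i<j (+-monoˡ-≤ 1 (unique∧⊆⇒length≤ unique λ x∈ → let fx , x<p = All.lookup xs<p x∈ in ∈-fermats fx x<p)))
... | q , _ , Fq = q , Fq

log₂[F∸1] : ∀ {q} → FermatPrime q → 2 ^ ⌊log₂ (q ∸ 1) ⌋ ≡ q ∸ 1
log₂[F∸1] (_ , l , refl) rewrite m+n∸n≡m (N l) 1 = cong (2 ^_) (⌊log₂[2^n]⌋≡n (2 ^ l))

1≤2^*product : ∀ a {ps} → All FermatPrime ps → 1 ≤ 2 ^ a * product ps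
1≤2^*product a fps = *-mono-≤ (m^n>0 2 a) (productOfPrimes≥1 (All.map proj₁ fps))

-- The three properties of ℱ

ℱ⊆N₂ : ℱ ⊆ N₂
ℱ⊆N₂ x (k , suc a , ps , _ , _ , first , refl , a≤) = φ x , (x , 1≤x , refl) , (1≤x , refl) , max
  where
  sorted : AllPairs _<_ ps
  sorted = FermatsFrom-sorted k first

  fps : All FermatPrime ps
  fps = FermatsFrom-fermat k first

  1≤x : 1 ≤ x
  1≤x = 1≤2^*product (suc a) fps

  fermat-split : ∀ {p} → FermatPrime p → p ∈ ps ⊎ (All (_< p) ps × 2 ^ suc a < p)
  fermat-split {p} fp with length (fermats p) + 1 ≤? k
  ... | yes j≤k with FermatsFrom-lookup k first (m≤n+m 1 (length (fermats p))) (subst (length (fermats p) + 1 <_) (+-comm 1 k) (s≤s j≤k))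
  ...   | q , q∈ps , Fq = inj₁ (subst (_∈ ps) (IsF-unique Fq (fermat⇒IsF fp)) q∈ps)
  -- The index of p exceeds k, so F_{k+1} exists and is at most p; the bound on a then gives 2^a ≤
  -- F_{k+1} - 1 < p.
  fermat-split {p} fp | no j≰k with IsF-below (fermat⇒IsF fp) {suc k} (s≤s z≤n) (≰⇒> j≰k)
  ...   | q , Fq@(fq , _) = inj₂ (ps<p , (begin-strict
          2 ^ suc a                 ≤⟨ ^-monoʳ-≤ 2 (a≤ q Fq) ⟩
          2 ^ ⌊log₂ (q ∸ 1) ⌋       ≡⟨ log₂[F∸1] fq ⟩
          q ∸ 1                     <⟨ ∸-monoʳ-< (s≤s z≤n) (<⇒≤ (prime>1 (proj₁ fq))) ⟩
          q                         ≤⟨ ≮⇒≥ (λ p<q → j≰k (s≤s⁻¹ (IsF-reflects-< (fermat⇒IsF fp) Fq p<q))) ⟩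
          p                         ∎))
    where
    open ≤-Reasoning
    ps<p : All (_< p) ps
    ps<p = All.map (λ (i , _ , i<k+1 , Fi) → IsF-mono-< Fi (fermat⇒IsF fp) (≤-trans (subst (i <_) (+-comm k 1) i<k+1) (≰⇒> j≰k)))
             (FermatsFrom⇒IsF k first)

  max : ∀ y → InPhiInv (φ x) y → y ≤ x
  max y (1≤y , φy≡φx) with φ-2^*product≡2^ a sorted fps
  ... | s , φx≡2^s = φ≡⇒≤ a s 1≤y sorted fps
        (λ pr 2<p p∣y → let fp = φ≡2^⇒fermat s 1≤y φy≡2^s pr 2<p p∣y in fp , fermat-split fp)
        φy≡2^s φy≡φx
    where
    φy≡2^s : φ y ≡ 2 ^ s
    φy≡2^s = trans φy≡φx φx≡2^s

fermat[3] : FermatPrime 3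
fermat[3] = prime[3] , 0 , refl

-- With a chosen first, k counts the Fermat primes up to 2^a: no decision on
-- whether there are infinitely many Fermat primes is needed.
ℱ-infinite : Infinite ℱ
ℱ-infinite n = x , (k , a , ps , (1≤k , last) , s≤s z≤n , fermats-first b , refl , a≤) , n≤x
  where
  -- The summand 2 makes 2^a ≥ 4, so that 3 is among `ps` and `1 ≤ k`.
  a = 2 + n
  b = suc (2 ^ a)
  ps = fermats b
  k = length ps
  x = 2 ^ a * product ps

  1≤k : 1 ≤ k
  1≤k = unique∧⊆⇒length≤ {xs = 3 ∷ []} ([] ∷ [])
    (λ { (here refl) → ∈-fermats fermat[3] (s≤s (≤-trans (n≤1+n 3) (^-monoʳ-≤ 2 (m≤m+n 2 n)))) })

  last : ∃[ p ] IsF k p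
  last with FermatsFrom-lookup k (fermats-first b) 1≤k (≤-reflexive (+-comm 1 k))
  ... | p , _ , Fp = p , Fp

  -- Any F_{k+1} lies outside `ps`, hence is at least `b`, that is 2^a + 1.
  a≤ : ∀ q → IsF (suc k) q → a ≤ ⌊log₂ (q ∸ 1) ⌋
  a≤ q Fq@(fq , _) = subst (_≤ ⌊log₂ (q ∸ 1) ⌋) (⌊log₂[2^n]⌋≡n a) (⌊log₂⌋-mono-≤ (∸-monoˡ-≤ 1 (≮⇒≥ q≮b)))
    where
    q≮b : ¬ q < b
    q≮b q<b with All.lookup (FermatsFrom⇒IsF k (fermats-first b)) (∈-fermats fq q<b)
    ... | j , _ , j<k+1 , Fj = <-irrefl refl (IsF-mono-< Fj Fq (subst (j <_) (+-comm k 1) j<k+1))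

  n≤x : n ≤ x
  n≤x = ≤-trans (m≤n+m n 2) (≤-trans (<⇒≤ (n<2^n a))
    (m≤m*n (2 ^ a) (product ps) {{productOfPrimes≢0 (All.map proj₁ (FermatsFrom-fermat k (fermats-first b)))}}))

-- Since `N 0` is 2, `fermat-ratio 0` reads 2x ≤ 4 φ(x) + x.
ℱ∩N₁-finite : FinitelyManyOf ℱ N₁
ℱ∩N₁-finite = 2310 , λ { x (k , suc a , ps , _ , _ , first , refl , _) → N₁⇒<2310 (x≤4φx k a first) }
  where
  x≤4φx : ∀ k a {ps} → FirstFermats k ps → 2 ^ suc a * product ps ≤ 4 * φ (2 ^ suc a * product ps)
  x≤4φx k a {ps} first with φ-2^*product≡2^ a (FermatsFrom-sorted k first) (FermatsFrom-fermat k first)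
  ... | s , φx≡2^s = +-cancelʳ-≤ x _ _ (subst (_≤ 4 * φ x + x) (cong (x +_) (+-identityʳ x))
        (fermat-ratio 0 1≤x λ pr 2<p p∣x → let _ , l , p≡ = φ≡2^⇒fermat s 1≤x φx≡2^s pr 2<p p∣x in l , z≤n , p≡))
    where
    x = 2 ^ suc a * product ps
    1≤x : 1 ≤ x
    1≤x = 1≤2^*product (suc a) (FermatsFrom-fermat k first)

theorem1p5 : (𝒦max ⊆ N₂ × Infinite 𝒦max × FinitelyManyOf 𝒦max N₁)
    × (ℛ ⊆ N₂ × Infinite ℛ × FinitelyManyOf ℛ N₁)
    × (ℱ ⊆ N₂ × Infinite ℱ × FinitelyManyOf ℱ N₁)
    × (𝒦min ⊆ N₃ × Infinite 𝒦min × InfinitelyManyOf 𝒦min Composite)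
theorem1p5 =
  (𝒦max⊆N₂ , 𝒦max-infinite , 𝒦max∩N₁-finite) ,
  (ℛ⊆N₂ , ℛ-infinite , ℛ∩N₁-finite) ,
  (ℱ⊆N₂ , ℱ-infinite , ℱ∩N₁-finite) ,
  (𝒦min⊆N₃ , 𝒦min-infinite , 𝒦min∩Composite-infinite)
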